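{- For every tree $T$ on $n\geq 2$ vertices one has the coefficientwise inequalities in $\mathbb{Z}[y]$ $$T_{\mathrm{Cone}(S_n)}(1,y) \leq T_{\mathrm{Cone}(T)}(1,y) \leq T_{\mathrm{Cone}(P_n)}(1,y).$$ In particular, $$2^{n-2}(n+1)=\tau(\mathrm{Cone}(S_n)) \leq \tau(\mathrm{Cone}(T)) \leq \tau(\mathrm{Cone}(P_n)) = F_{2n}.$$
   Context: $T_G(x,y)$ is the Tutte polynomial of a finite graph $G$ (loops and parallel edges allowed), defined recursively by: $T_G=T_{G\setminus e}+T_{G/e}$ if $e$ is neither a loop nor a coloop (bridge); $T_G=y\,T_{G\setminus e}$ if $e$ is a loop; $T_G=x\,T_{G/e}$ if $e$ is a coloop; $T_G=1$ if $G$ has no edges. Here $G\setminus e$ is deletion and $G/e$ contraction (identify the endpoints of $e$ and remove $e$). $\tau(G)=T_G(1,1)$ is the number of spanning trees. For a tree $T$, $\mathrm{Cone}(T)$ is obtained by adding a new vertex $v_0$ joined by one edge to each vertex of $T$. $P_n$ is the path and $S_n=K_{1,n-1}$ the star on $n$ vertices. $F_n$ are the Fibonacci numbers ($F_0=0,F_1=1,F_n=F_{n-1}+F_{n-2}$). Coefficientwise inequality $f\leq g$ means each coefficient of $g-f$ is nonnegative. -}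

module Defs where

open import Data.Nat using (ℕ; zero; suc; _+_; _*_; _∸_; _^_; _≤_; _<_; _≡ᵇ_)
open import Data.Bool using (Bool; true; false; if_then_else_; _∨_)
open import Data.List using (List; []; _∷_; _++_; map; foldr; length; upTo; concatMap)
open import Data.Nat.ListAction using (sum)
open import Data.Bool.ListAction using (any)
open import Data.List.Relation.Unary.All using (All)
open import Data.List.Relation.Unary.Unique.Propositional using (Unique)
open import Data.Fin using (Fin)
open import Data.Product using (Σ; _×_; _,_; proj₁; proj₂)
open import Data.Empty using (⊥)
open import Relation.Binary.PropositionalEquality using (_≡_; _≢_)
open import Data.List.Base using (lookup)
open import Data.List.Membership.Propositional using (_∈_)

-- Multigraphs (loops and parallel edges allowed), vertices labelled by ℕ.
-- A graph is given by its list of edges; an edge is an (unordered) pair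
-- of endpoints.  Isolated vertices do not affect the Tutte polynomial.

Edge : Set
Edge = ℕ × ℕ

Graph : Set
Graph = List Edge

-- Polynomials with ℕ coefficients.
-- Poly1 : coefficient list [c₀, c₁, …] of Σ cⱼ yʲ.
-- Poly2 : list of rows; row i is the Poly1 coefficient of xⁱ.

Poly1 : Set
Poly1 = List ℕ

Poly2 : Set
Poly2 = List Poly1

add1 : Poly1 → Poly1 → Poly1
add1 [] q = q
add1 (a ∷ p) [] = a ∷ p
add1 (a ∷ p) (b ∷ q) = (a + b) ∷ add1 p q

add2 : Poly2 → Poly2 → Poly2
add2 [] q = q
add2 (a ∷ p) [] = a ∷ p
add2 (a ∷ p) (b ∷ q) = add1 a b ∷ add2 p q

one2 : Poly2
one2 = (1 ∷ []) ∷ []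

mulX : Poly2 → Poly2
mulX p = [] ∷ p

mulY : Poly2 → Poly2
mulY p = map (0 ∷_) p

evalX1 : Poly2 → Poly1
evalX1 = foldr add1 []

coeff : Poly1 → ℕ → ℕ
coeff [] j = 0
coeff (a ∷ p) zero = a
coeff (a ∷ p) (suc j) = coeff p j

_≤ᶜ_ : Poly1 → Poly1 → Set
p ≤ᶜ q = ∀ j → coeff p j ≤ coeff q j

evalY1 : Poly1 → ℕ
evalY1 = sum

mem : ℕ → List ℕ → Bool
mem v S = any (λ w → w ≡ᵇ v) S

step : Graph → List ℕ → List ℕ
step es S = S ++ concatMap (λ e → (if mem (proj₁ e) S then proj₂ e ∷ [] else [])
                                 ++ (if mem (proj₂ e) S then proj₁ e ∷ [] else [])) es

iter : ℕ → Graph → List ℕ → List ℕ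
iter zero es S = S
iter (suc k) es S = iter k es (step es S)

reachable : Graph → ℕ → ℕ → Bool
reachable es u v = mem v (iter (suc (length es)) es (u ∷ []))

-- Tutte polynomial by the deletion–contraction recursion, always
-- applied to the first edge of the list.  Contraction is kept lazily as a
-- vertex renaming ρ (contracting e = {u,v} identifies v with u).

mapE : (ℕ → ℕ) → Graph → Graph
mapE ρ = map (λ e → ρ (proj₁ e) , ρ (proj₂ e))

tutteρ : (ℕ → ℕ) → Graph → Poly2
tutteρ ρ [] = one2
tutteρ ρ ((a , b) ∷ es) =
  let u = ρ a
      v = ρ b
      ρ' = λ w → if ρ w ≡ᵇ v then u else ρ w
  in if u ≡ᵇ v
     then mulY (tutteρ ρ es)
     else (if reachable (mapE ρ es) u v
           then add2 (tutteρ ρ es) (tutteρ ρ' es)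
           else mulX (tutteρ ρ' es))

tutte : Graph → Poly2
tutte G = tutteρ (λ w → w) G

tutteX1 : Graph → Poly1
tutteX1 G = evalX1 (tutte G)

-- number of spanning trees τ(G) = T_G(1,1)
τ : Graph → ℕ
τ G = evalY1 (tutteX1 G)

data Walk (es : Graph) : ℕ → ℕ → Set where
  here : ∀ {u} → Walk es u u
  fwd  : ∀ {u w v} → (u , w) ∈ es → Walk es w v → Walk es u v
  bwd  : ∀ {u w v} → (w , u) ∈ es → Walk es w v → Walk es u v

-- trails given by the list of positions (in es) of the edges traversed;
-- positions distinguish parallel edges.
data Trail (es : Graph) : ℕ → ℕ → List (Fin (length es)) → Set where
  nil  : ∀ {u} → Trail es u u []
  fwd  : ∀ {v is} (i : Fin (length es)) →
         Trail es (proj₂ (lookup es i)) v is → Trail es (proj₁ (lookup es i)) v (i ∷ is)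
  bwd  : ∀ {v is} (i : Fin (length es)) →
         Trail es (proj₁ (lookup es i)) v is → Trail es (proj₂ (lookup es i)) v (i ∷ is)

HasCycle : Graph → Set
HasCycle es = Σ ℕ λ u → Σ (List (Fin (length es))) λ is →
  Trail es u u is × Unique is × is ≢ []

Acyclic : Graph → Set
Acyclic es = HasCycle es → ⊥

OnVertices : ℕ → Graph → Set
OnVertices n es = All (λ e → proj₁ e < n × proj₂ e < n) es

Connected : ℕ → Graph → Set
Connected n es = ∀ u v → u < n → v < n → Walk es u v

IsTree : ℕ → Graph → Set
IsTree n es = OnVertices n es × Connected n es × Acyclic es

cone : ℕ → Graph → Graph
cone n es = es ++ map (λ i → (n , i)) (upTo n)

pathG : ℕ → Graph
pathG n = map (λ i → (i , suc i)) (upTo (n ∸ 1))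

starG : ℕ → Graph
starG n = map (λ i → (0 , suc i)) (upTo (n ∸ 1))

fib : ℕ → ℕ
fib zero = 0
fib (suc zero) = 1
fib (suc (suc n)) = fib (suc n) + fib n

{-# OPTIONS --safe #-}

-- Let F(T) = T_{Cone(T)}(1,y) = Σ_A Π_C (1 + y + … + y^{|C|−1}), where A runs over
-- the subsets of E(T) and C over the components of (V(T),A), and for a rooted tree
-- let a(T) be the same sum with the factor of the root's component omitted.  If an
-- edge uv joins T₁ ∋ u to T₂ ∋ v, then
--   F(T) = a(T₁) F(T₂) + F(T₁) a(T₂) + y F(T₁) F(T₂)   with roots u and v,
--   a(T) = a(T₂) (F(T₁) + a(T₁))                       for T rooted at v.
-- Both right-hand sides are monotone in all arguments, so the bounds follow by
-- induction once they are checked for the join of two stars (rooted at the centre)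
-- or of two paths (rooted at an end).
-- The two formulas come from series–parallel reduction: in a generalised
-- deletion–contraction expansion, which is invariant under permutations of the
-- edges, each leaf of the tree is absorbed into its neighbour.
module Submission where

open import Defs
open import Algebra.Bundles using (CommutativeSemiring)
open import Algebra.Structures.Biased using (isCommutativeSemiringˡ)
open import Data.Bool using (true; false; if_then_else_)
open import Data.Bool.Properties using (T-≡)
open import Data.Empty using (⊥-elim)
open import Data.Fin using (Fin)
import Data.Fin.Properties as Finₚ
open import Data.List using (List; []; _∷_; [_]; _++_; map; length; upTo; applyUpTo; lookup)
import Data.List.Membership.DecPropositional as DecMembership
open import Data.List.Membership.Propositional using (_∈_; _∉_; lose; find)
open import Data.List.Membership.Propositional.Properties
  using (∈-++⁺ˡ; ∈-++⁺ʳ; ∈-++⁻; ∈-map⁺; ∈-map⁻; ∈-concatMap⁺; ∈-concatMap⁻; ∈-upTo⁺; ∈-upTo⁻; ∈-lookup; ∈-allFin)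
open import Data.List.Membership.Propositional.Properties.WithK using (unique∧set⇒bag)
open import Data.List.Properties
  using (map-++; map-tabulate; tabulate-lookup; length-upTo; map-upTo; map-applyUpTo; length-applyUpTo)
open import Data.List.Relation.Binary.BagAndSetEquality using (∼bag⇒↭)
open import Data.List.Relation.Binary.Permutation.Propositional as ↭
  using (_↭_; ↭-refl; ↭-reflexive; ↭-sym; ↭-trans; ↭-prep; ↭-swap)
open import Data.List.Relation.Binary.Permutation.Propositional.Properties as ↭ₚ
  using (shift; ++⁺ˡ; ↭-length; All-resp-↭)
open import Data.List.Relation.Binary.Pointwise using (Pointwise; []; _∷_)
open import Data.List.Relation.Unary.All as All using (All; []; _∷_)
open import Data.List.Relation.Unary.All.Properties as Allₚ using (¬Any⇒All¬)
open import Data.List.Relation.Unary.Any as Any using (here; there)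
open import Data.List.Relation.Unary.Any.Properties using (any⁺; any⁻; lookup-index)
open import Data.List.Relation.Unary.Unique.Propositional using (Unique; []; _∷_)
open import Data.List.Relation.Unary.Unique.Propositional.Properties as Uniqueₚ using (upTo⁺; allFin⁺)
open import Data.Nat using (ℕ; zero; suc; _+_; _*_; _∸_; _^_; _≤_; _<_; z≤n; s≤s; _≟_; _≡ᵇ_)
open import Data.Nat.Properties as ℕₚ using (≤-refl; ≤-trans; +-mono-≤; *-mono-≤)
open import Data.Nat.Tactic.RingSolver using (solve-∀)
open import Data.Product using (∃; ∃₂; _×_; _,_; proj₁; proj₂)
open import Data.Sum using (_⊎_; inj₁; inj₂)
open import Data.Unit using (⊤; tt)
open import Function using (case_of_; _∘_; mk⇔; Equivalence)
open import Relation.Binary.Bundles using (Preorder)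
open import Relation.Binary.PropositionalEquality
  using (_≡_; _≢_; refl; sym; trans; cong; cong₂; subst; ≢-sym; module ≡-Reasoning)
open import Relation.Binary.Structures using (IsEquivalence)
open import Relation.Nullary using (¬_; does; yes; no; contradiction)
open import Relation.Nullary.Decidable using (dec-true; dec-false)

-- The obstacle is that `tutte` fixes the edge order and branches on a reachability test, so a leaf
-- of the tree cannot be brought to the front directly. At x = 1 a coloop needs no rule of its own:
-- its deletion disconnects the graph and may be counted as 0. One rule then covers every non-loop
-- edge, provided that connectivity is tested at the end. Edges are moreover allowed to carry
-- networks with three weights. The law γ + α = yα + β is what makes edges that become parallel
-- commute; it is written as a sum, and cancelled rather than subtracted, because coefficients are
-- natural numbers. On the spoke from the apex to v, the network standing for an absorbed tree
-- rooted at v has α = F and β = a. An abstract tree supplies the order of absorption through a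
-- subtree grown along walks; acyclicity forces this subtree to use every edge.

-- A polynomial is compared through its coefficient sequence.
Series : Set
Series = ℕ → ℕ

-- The ordered semiring of coefficient sequences

infix 4 _≈_ _≼_
infixl 6 _⊕_
infixl 7 _⊛_

-- A record rather than a bare pointwise statement, so that unification can recover the two series
-- from the type.
record _≈_ (f g : Series) : Set where
  constructor mk≈
  field at : ∀ j → f j ≡ g j
open _≈_

record _≼_ (f g : Series) : Set where
  constructor mk≼
  field at≼ : ∀ j → f j ≤ g j
open _≼_

tail : Series → Series
tail f j = f (suc j)

_⊕_ _⊛_ : Series → Series → Series
(f ⊕ g) j = f j + g j
(f ⊛ g) zero = f 0 * g 0
(f ⊛ g) (suc j) = f 0 * g (suc j) + (tail f ⊛ g) j

𝟘 𝟙 y : Series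
𝟘 = coeff []
𝟙 = coeff (1 ∷ [])
y = coeff (0 ∷ 1 ∷ [])

≈-isEquivalence : IsEquivalence _≈_
≈-isEquivalence = record
  { refl = mk≈ (λ _ → refl)
  ; sym = λ p → mk≈ (λ j → sym (at p j))
  ; trans = λ p q → mk≈ (λ j → trans (at p j) (at q j))
  }

open IsEquivalence ≈-isEquivalence using ()
  renaming (refl to ≈-refl; sym to ≈-sym; trans to ≈-trans; reflexive to ≈-reflexive)

⊛-at-cong : ∀ {f f′ g g′} → (∀ j → f j ≡ f′ j) → (∀ j → g j ≡ g′ j) → ∀ j → (f ⊛ g) j ≡ (f′ ⊛ g′) j
⊛-at-cong p q zero = cong₂ _*_ (p 0) (q 0)
⊛-at-cong p q (suc j) = cong₂ _+_ (cong₂ _*_ (p 0) (q (suc j))) (⊛-at-cong (λ i → p (suc i)) q j)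

-- The definition of the product peels off `f 0`; peeling off `g 0` instead is what commutativity
-- needs.
⊛-suc : ∀ f g j → (f ⊛ g) (suc j) ≡ (f ⊛ tail g) j + f (suc j) * g 0
⊛-suc f g zero = refl
⊛-suc f g (suc j) = trans (cong (f 0 * g (suc (suc j)) +_) (⊛-suc (tail f) g j))
  (sym (ℕₚ.+-assoc (f 0 * g (suc (suc j))) _ _))

⊛-comm : ∀ f g j → (f ⊛ g) j ≡ (g ⊛ f) j
⊛-comm f g zero = ℕₚ.*-comm (f 0) (g 0)
⊛-comm f g (suc j) = begin
  f 0 * g (suc j) + (tail f ⊛ g) j  ≡⟨ cong₂ _+_ (ℕₚ.*-comm (f 0) _) (⊛-comm (tail f) g j) ⟩
  g (suc j) * f 0 + (g ⊛ tail f) j  ≡⟨ ℕₚ.+-comm (g (suc j) * f 0) _ ⟩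
  (g ⊛ tail f) j + g (suc j) * f 0  ≡⟨ ⊛-suc g f j ⟨
  (g ⊛ f) (suc j)                   ∎
  where open ≡-Reasoning

⊛-distribʳ : ∀ h f g j → ((f ⊕ g) ⊛ h) j ≡ (f ⊛ h ⊕ g ⊛ h) j
⊛-distribʳ h f g zero = ℕₚ.*-distribʳ-+ (h 0) (f 0) (g 0)
⊛-distribʳ h f g (suc j) rewrite ⊛-distribʳ h (tail f) (tail g) j =
  lemma (f 0) (g 0) (h (suc j)) _ _
  where
  lemma : ∀ a b c u v → (a + b) * c + (u + v) ≡ a * c + u + (b * c + v)
  lemma = solve-∀

⊛-scale : ∀ a f g j → ((λ i → a * f i) ⊛ g) j ≡ a * (f ⊛ g) j
⊛-scale a f g zero = ℕₚ.*-assoc a (f 0) (g 0)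
⊛-scale a f g (suc j) rewrite ⊛-scale a (tail f) g j = lemma a (f 0) (g (suc j)) _
  where
  lemma : ∀ a b c u → a * b * c + a * u ≡ a * (b * c + u)
  lemma = solve-∀

⊛-assoc : ∀ f g h j → ((f ⊛ g) ⊛ h) j ≡ (f ⊛ (g ⊛ h)) j
⊛-assoc f g h zero = ℕₚ.*-assoc (f 0) (g 0) (h 0)
⊛-assoc f g h (suc j)
  rewrite ⊛-distribʳ h (λ i → f 0 * tail g i) (tail f ⊛ g) j
        | ⊛-scale (f 0) (tail g) h j | ⊛-assoc (tail f) g h j =
  lemma (f 0) (g 0) (h (suc j)) _ _
  where
  lemma : ∀ a b c u v → a * b * c + (a * u + v) ≡ a * (b * c + u) + v
  lemma = solve-∀

⊛-zeroˡ : ∀ f j → (𝟘 ⊛ f) j ≡ 0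
⊛-zeroˡ f zero = refl
⊛-zeroˡ f (suc j) = ⊛-zeroˡ f j

⊛-identityˡ : ∀ f j → (𝟙 ⊛ f) j ≡ f j
⊛-identityˡ f zero = ℕₚ.*-identityˡ (f 0)
⊛-identityˡ f (suc j) rewrite ⊛-zeroˡ f j = trans (ℕₚ.+-identityʳ _) (ℕₚ.*-identityˡ _)

⊛-identityʳ : ∀ f j → (f ⊛ 𝟙) j ≡ f j
⊛-identityʳ f j = trans (⊛-comm f 𝟙 j) (⊛-identityˡ f j)

seriesSemiring : CommutativeSemiring _ _
seriesSemiring = record
  { Carrier = Series ; _≈_ = _≈_ ; _+_ = _⊕_ ; _*_ = _⊛_ ; 0# = 𝟘 ; 1# = 𝟙
  ; isCommutativeSemiring = isCommutativeSemiringˡ record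
    { +-isCommutativeMonoid = record
      { isMonoid = record
        { isSemigroup = record
          { isMagma = record
            { isEquivalence = ≈-isEquivalence
            ; ∙-cong = λ p q → mk≈ (λ j → cong₂ _+_ (at p j) (at q j)) }
          ; assoc = λ f g h → mk≈ (λ j → ℕₚ.+-assoc (f j) (g j) (h j)) }
        ; identity = (λ f → ≈-refl) , (λ f → mk≈ (λ j → ℕₚ.+-identityʳ (f j))) }
      ; comm = λ f g → mk≈ (λ j → ℕₚ.+-comm (f j) (g j)) }
    ; *-isCommutativeMonoid = record
      { isMonoid = record
        { isSemigroup = record
          { isMagma = record
            { isEquivalence = ≈-isEquivalence
            ; ∙-cong = λ p q → mk≈ (⊛-at-cong (at p) (at q)) }
          ; assoc = λ f g h → mk≈ (⊛-assoc f g h) }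
        ; identity = (λ f → mk≈ (⊛-identityˡ f)) , (λ f → mk≈ (⊛-identityʳ f)) }
      ; comm = λ f g → mk≈ (⊛-comm f g) }
    ; distribʳ = λ h f g → mk≈ (⊛-distribʳ h f g)
    ; zeroˡ = λ f → mk≈ (⊛-zeroˡ f)
    }
  }

open CommutativeSemiring seriesSemiring using (setoid)
  renaming (+-cong to ⊕-cong; *-cong to ⊛-cong; +-comm to ⊕-comm)
open import Algebra.Solver.Ring.NaturalCoefficients.Default seriesSemiring
open import Relation.Binary.Reasoning.Setoid setoid as ≈-Reasoning using ()

-- Replaces subtraction when two parallel edges are exchanged in `Φ-swap`.
⊕-cancelʳ : ∀ {f g} h → f ⊕ h ≈ g ⊕ h → f ≈ g
⊕-cancelʳ h p = mk≈ (λ j → ℕₚ.+-cancelʳ-≡ (h j) _ _ (at p j))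

⊛-at-mono : ∀ {f f′ g g′} → (∀ j → f j ≤ f′ j) → (∀ j → g j ≤ g′ j) → ∀ j → (f ⊛ g) j ≤ (f′ ⊛ g′) j
⊛-at-mono p q zero = *-mono-≤ (p 0) (q 0)
⊛-at-mono p q (suc j) = +-mono-≤ (*-mono-≤ (p 0) (q (suc j))) (⊛-at-mono (λ i → p (suc i)) q j)

⊕-mono : ∀ {f f′ g g′} → f ≼ f′ → g ≼ g′ → f ⊕ g ≼ f′ ⊕ g′
⊕-mono p q = mk≼ (λ j → +-mono-≤ (at≼ p j) (at≼ q j))

⊛-mono : ∀ {f f′ g g′} → f ≼ f′ → g ≼ g′ → f ⊛ g ≼ f′ ⊛ g′
⊛-mono p q = mk≼ (⊛-at-mono (at≼ p) (at≼ q))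

≼-refl : ∀ {f} → f ≼ f
≼-refl = mk≼ (λ _ → ≤-refl)

≼-reflexive : ∀ {f g} → f ≈ g → f ≼ g
≼-reflexive p = mk≼ (λ j → ℕₚ.≤-reflexive (at p j))

≼-trans : ∀ {f g h} → f ≼ g → g ≼ h → f ≼ h
≼-trans p q = mk≼ (λ j → ≤-trans (at≼ p j) (at≼ q j))

≼-preorder : Preorder _ _ _
≼-preorder = record
  { _≈_ = _≈_ ; _≲_ = _≼_
  ; isPreorder = record
    { isEquivalence = ≈-isEquivalence ; reflexive = ≼-reflexive ; trans = ≼-trans } }

open import Relation.Binary.Reasoning.Preorder ≼-preorder as ≼-Reasoning using ()

⊕-increasing : ∀ f g → f ≼ f ⊕ g
⊕-increasing f g = mk≼ (λ j → ℕₚ.m≤m+n (f j) (g j))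

⟦add1⟧ : ∀ p q → coeff (add1 p q) ≈ coeff p ⊕ coeff q
⟦add1⟧ p q = mk≈ (go p q)
  where
  go : ∀ p q j → coeff (add1 p q) j ≡ coeff p j + coeff q j
  go [] q j = refl
  go (a ∷ p) [] j = sym (ℕₚ.+-identityʳ _)
  go (a ∷ p) (b ∷ q) zero = refl
  go (a ∷ p) (b ∷ q) (suc j) = go p q j

⟦0∷⟧ : ∀ p → coeff (0 ∷ p) ≈ y ⊛ coeff p
⟦0∷⟧ p = mk≈ λ { zero → refl ; (suc j) → sym (⊛-identityˡ (coeff p) j) }

-- Join formulas for stars and paths

-- The values a and F of the tree obtained by joining the roots of two trees by an
-- edge and keeping the root of the second.
joinA : (a₁ F₁ a₂ : Series) → Series
joinA a₁ F₁ a₂ = a₂ ⊛ (F₁ ⊕ a₁)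

joinF : (a₁ F₁ a₂ F₂ : Series) → Series
joinF a₁ F₁ a₂ F₂ = a₁ ⊛ F₂ ⊕ F₁ ⊛ a₂ ⊕ y ⊛ F₁ ⊛ F₂

joinF-cong : ∀ {a₁ F₁ a₂ F₂ a₁′ F₁′ a₂′ F₂′} → a₁ ≈ a₁′ → F₁ ≈ F₁′ → a₂ ≈ a₂′ → F₂ ≈ F₂′ →
  joinF a₁ F₁ a₂ F₂ ≈ joinF a₁′ F₁′ a₂′ F₂′
joinF-cong p q r s = ⊕-cong (⊕-cong (⊛-cong p s) (⊛-cong q r)) (⊛-cong (⊛-cong ≈-refl q) s)

joinF-mono : ∀ {a₁ F₁ a₂ F₂ a₁′ F₁′ a₂′ F₂′} → a₁ ≼ a₁′ → F₁ ≼ F₁′ → a₂ ≼ a₂′ → F₂ ≼ F₂′ →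
  joinF a₁ F₁ a₂ F₂ ≼ joinF a₁′ F₁′ a₂′ F₂′
joinF-mono p q r s = ⊕-mono (⊕-mono (⊛-mono p s) (⊛-mono q r)) (⊛-mono (⊛-mono ≼-refl q) s)

-- In these four families the index is the number of edges of the tree; the star
-- is rooted at its centre, the path at an end.
starA : ℕ → Series
starA m = coeff (2 ^ m ∷ [])

starPoly : ℕ → Poly1
starPoly zero = 1 ∷ []
starPoly (suc m) = add1 (add1 (starPoly m) (0 ∷ starPoly m)) (2 ^ m ∷ [])

starF : ℕ → Series
starF m = coeff (starPoly m)

pathPolyA pathPolyF : ℕ → Poly1
pathPolyA zero = 1 ∷ []
pathPolyA (suc m) = add1 (pathPolyA m) (pathPolyF m)
pathPolyF zero = 1 ∷ []
pathPolyF (suc m) = add1 (pathPolyF m) (add1 (pathPolyA m) (0 ∷ pathPolyF m))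

pathA pathF : ℕ → Series
pathA m = coeff (pathPolyA m)
pathF m = coeff (pathPolyF m)

starA-suc : ∀ m → starA (suc m) ≈ starA m ⊕ starA m
starA-suc m = mk≈ λ { zero → cong (2 ^ m +_) (ℕₚ.+-identityʳ _) ; (suc j) → refl }

starA-+ : ∀ m k → starA (m + k) ≈ starA m ⊛ starA k
starA-+ m k = mk≈ λ
  { zero → ℕₚ.^-distribˡ-+-* 2 m k
  ; (suc j) → sym (trans (cong₂ _+_ (ℕₚ.*-zeroʳ (2 ^ m)) (⊛-zeroˡ (starA k) j)) refl) }

-- The right-hand side is `joinF 𝟙 𝟙 (starA m) (starF m)`: a single vertex is attached to the
-- centre.
starF-suc : ∀ m → starF (suc m) ≈ starF m ⊕ y ⊛ starF m ⊕ starA m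
starF-suc m = ≈-trans (⟦add1⟧ (add1 (starPoly m) (0 ∷ starPoly m)) _)
  (⊕-cong (≈-trans (⟦add1⟧ (starPoly m) _) (⊕-cong ≈-refl (⟦0∷⟧ (starPoly m)))) ≈-refl)

-- The new vertex becomes the root: here and in `pathF-suc` the path is the first tree of the join
-- and a single vertex, with a = F = 1, the second.
pathA-suc : ∀ m → pathA (suc m) ≈ pathA m ⊕ pathF m
pathA-suc m = ⟦add1⟧ (pathPolyA m) _

pathF-suc : ∀ m → pathF (suc m) ≈ pathF m ⊕ (pathA m ⊕ y ⊛ pathF m)
pathF-suc m = ≈-trans (⟦add1⟧ (pathPolyF m) _)
  (⊕-cong ≈-refl (≈-trans (⟦add1⟧ (pathPolyA m) _) (⊕-cong ≈-refl (⟦0∷⟧ (pathPolyF m)))))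

starA≼starF : ∀ m → starA m ≼ starF m
starA≼starF zero = ≼-refl
starA≼starF (suc m) = begin
  starA (suc m)                          ≈⟨ starA-suc m ⟩
  starA m ⊕ starA m                      ≲⟨ ⊕-mono (≼-trans (starA≼starF m) (⊕-increasing _ _)) ≼-refl ⟩
  starF m ⊕ y ⊛ starF m ⊕ starA m        ≈⟨ starF-suc m ⟨
  starF (suc m)                          ∎
  where open ≼-Reasoning

-- The right-hand side belongs to two stars joined at their centres. Moving a leaf into the first
-- star changes both sides by almost the same recurrence.
starF-superadditive : ∀ m k → starF (suc (m + k)) ≼ joinF (starA m) (starF m) (starA k) (starF k)
starF-superadditive zero k = ≼-reflexive (≈-trans (starF-suc k)
  (solve 3 (λ y a F → F :+ y :* F :+ a := con 1 :* F :+ con 1 :* a :+ y :* con 1 :* F)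
    ≈-refl y (starA k) (starF k)))
starF-superadditive (suc m) k = begin
  starF (suc (suc (m + k)))
    ≈⟨ starF-suc (suc (m + k)) ⟩
  S ⊕ y ⊛ S ⊕ starA (suc (m + k))
    ≈⟨ ⊕-cong ≈-refl (≈-trans (starA-suc (m + k)) (⊕-cong (starA-+ m k) (starA-+ m k))) ⟩
  S ⊕ y ⊛ S ⊕ (a ⊛ b ⊕ a ⊛ b)
    -- Apart from the induction hypothesis, the only loss is that one copy of `a ⊛ b` grows to
    -- `a ⊛ G`.
    ≲⟨ ⊕-mono (⊕-mono ih (⊛-mono ≼-refl ih)) (⊕-mono (⊛-mono ≼-refl (starA≼starF k)) ≼-refl) ⟩
  D ⊕ y ⊛ D ⊕ (a ⊛ G ⊕ a ⊛ b)
    ≈⟨ solve 5 (λ y a F b G →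
         let D = a :* G :+ F :* b :+ y :* F :* G
             F′ = F :+ y :* F :+ a in
         D :+ y :* D :+ (a :* G :+ a :* b) := (a :+ a) :* G :+ F′ :* b :+ y :* F′ :* G)
         ≈-refl y a F b G ⟩
  joinF (a ⊕ a) (F ⊕ y ⊛ F ⊕ a) b G
    ≈⟨ joinF-cong (starA-suc m) (starF-suc m) ≈-refl ≈-refl ⟨
  joinF (starA (suc m)) (starF (suc m)) b G ∎
  where
  open ≼-Reasoning
  S = starF (suc (m + k))
  a = starA m
  b = starA k
  F = starF m
  G = starF k
  D = joinF a F b G
  ih : S ≼ D
  ih = starF-superadditive m k

-- Joining two paths at their ends gives a path, and the value F does not depend
-- on the root: one edge at a time is moved from the second path to the first.
pathF-join : ∀ m k → joinF (pathA m) (pathF m) (pathA k) (pathF k) ≈ pathF (suc (m + k))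
pathF-join m zero = begin
  joinF a F 𝟙 𝟙         ≈⟨ solve 3 (λ y a F → a :* con 1 :+ F :* con 1 :+ y :* F :* con 1
                             := F :+ (a :+ y :* F)) ≈-refl y a F ⟩
  F ⊕ (a ⊕ y ⊛ F)       ≈⟨ pathF-suc m ⟨
  pathF (suc m)         ≡⟨ cong (λ i → pathF (suc i)) (ℕₚ.+-identityʳ m) ⟨
  pathF (suc (m + 0))   ∎
  where
  open ≈-Reasoning
  a = pathA m
  F = pathF m
pathF-join m (suc k) = begin
  joinF a F (pathA (suc k)) (pathF (suc k))
    ≈⟨ joinF-cong ≈-refl ≈-refl (pathA-suc k) (pathF-suc k) ⟩
  joinF a F (b ⊕ G) (G ⊕ (b ⊕ y ⊛ G))
    ≈⟨ solve 5 (λ y a F b G →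
         let join = λ a F b G → a :* G :+ F :* b :+ y :* F :* G in
         join a F (b :+ G) (G :+ (b :+ y :* G)) := join (a :+ F) (F :+ (a :+ y :* F)) b G)
         ≈-refl y a F b G ⟩
  joinF (a ⊕ F) (F ⊕ (a ⊕ y ⊛ F)) b G
    ≈⟨ joinF-cong (pathA-suc m) (pathF-suc m) ≈-refl ≈-refl ⟨
  joinF (pathA (suc m)) (pathF (suc m)) b G
    ≈⟨ pathF-join (suc m) k ⟩
  pathF (suc (suc m + k))
    ≡⟨ cong (λ i → pathF (suc i)) (ℕₚ.+-suc m k) ⟨
  pathF (suc (m + suc k)) ∎
  where
  open ≈-Reasoning
  a = pathA m
  F = pathF m
  b = pathA k
  G = pathF k

-- The left-hand side is the weight a of two paths joined at their ends and rooted at the joint of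
-- the second. In k, both sides of this and of `pathF⊛pathA` obey the recurrences of `pathA` and
-- `pathF`, so only k = 0 matters: equality for the first, loss of a term `y ⊛ pathF m` for the
-- second.
pathA-superadditive : ∀ m k → pathA k ⊛ pathA (suc m) ≼ pathA (suc (m + k))
pathF⊛pathA : ∀ m k → pathF k ⊛ pathA (suc m) ≼ pathF (suc (m + k))

pathA-superadditive m zero = ≼-reflexive
  (≈-trans (mk≈ (⊛-identityˡ _)) (mk≈ λ j → cong (λ i → pathA (suc i) j) (sym (ℕₚ.+-identityʳ m))))
pathA-superadditive m (suc k) = begin
  pathA (suc k) ⊛ c                      ≈⟨ ⊛-cong (pathA-suc k) ≈-refl ⟩
  (pathA k ⊕ pathF k) ⊛ c                ≈⟨ solve 3 (λ a F c → (a :+ F) :* c := a :* c :+ F :* c)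
                                              ≈-refl (pathA k) (pathF k) c ⟩
  pathA k ⊛ c ⊕ pathF k ⊛ c              ≲⟨ ⊕-mono (pathA-superadditive m k) (pathF⊛pathA m k) ⟩
  pathA (suc (m + k)) ⊕ pathF (suc (m + k)) ≈⟨ pathA-suc (suc (m + k)) ⟨
  pathA (suc (suc (m + k)))              ≡⟨ cong (λ i → pathA (suc i)) (ℕₚ.+-suc m k) ⟨
  pathA (suc (m + suc k))                ∎
  where
  open ≼-Reasoning
  c = pathA (suc m)

pathF⊛pathA m zero = begin
  𝟙 ⊛ pathA (suc m)                  ≈⟨ mk≈ (⊛-identityˡ _) ⟩
  pathA (suc m)                      ≈⟨ pathA-suc m ⟩
  pathA m ⊕ pathF m                  ≈⟨ ⊕-comm (pathA m) (pathF m) ⟩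
  pathF m ⊕ pathA m                  ≲⟨ ⊕-mono {pathF m} ≼-refl (⊕-increasing (pathA m) _) ⟩
  pathF m ⊕ (pathA m ⊕ y ⊛ pathF m)  ≈⟨ pathF-suc m ⟨
  pathF (suc m)                      ≡⟨ cong (λ i → pathF (suc i)) (ℕₚ.+-identityʳ m) ⟨
  pathF (suc (m + 0))                ∎
  where open ≼-Reasoning
pathF⊛pathA m (suc k) = begin
  pathF (suc k) ⊛ c                      ≈⟨ ⊛-cong (pathF-suc k) ≈-refl ⟩
  (F ⊕ (a ⊕ y ⊛ F)) ⊛ c                  ≈⟨ solve 4 (λ y a F c → (F :+ (a :+ y :* F)) :* c
                                              := F :* c :+ (a :* c :+ y :* (F :* c))) ≈-refl y a F c ⟩
  F ⊛ c ⊕ (a ⊛ c ⊕ y ⊛ (F ⊛ c))          ≲⟨ ⊕-mono ih (⊕-mono (pathA-superadditive m k) (⊛-mono ≼-refl ih)) ⟩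
  P ⊕ (pathA (suc (m + k)) ⊕ y ⊛ P)      ≈⟨ pathF-suc (suc (m + k)) ⟨
  pathF (suc (suc (m + k)))              ≡⟨ cong (λ i → pathF (suc i)) (ℕₚ.+-suc m k) ⟨
  pathF (suc (m + suc k))                ∎
  where
  open ≼-Reasoning
  a = pathA k
  F = pathF k
  c = pathA (suc m)
  P = pathF (suc (m + k))
  ih : F ⊛ c ≼ P
  ih = pathF⊛pathA m k

-- Bounds preserved by joins

-- The join formulas mix a and F, so both are bounded simultaneously, for an arbitrary root. `a≼F`
-- bounds F + a below by twice the star weight, and lets a ⊛ b be enlarged to a ⊛ G.
record Bounded (m : ℕ) (a F : Series) : Set where
  field
    star≼a : starA m ≼ a
    star≼F : starF m ≼ F
    a≼F    : a ≼ F
    a≼path : a ≼ pathA m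
    F≼path : F ≼ pathF m
open Bounded

bounded-unit : Bounded 0 𝟙 𝟙
bounded-unit = record
  { star≼a = ≼-refl ; star≼F = ≼-refl ; a≼F = ≼-refl ; a≼path = ≼-refl ; F≼path = ≼-refl }

bounded-join : ∀ {m k a F b G} → Bounded m a F → Bounded k b G →
  Bounded (suc (m + k)) (joinA a F b) (joinF a F b G)
bounded-join {m} {k} {a} {F} {b} {G} A B = record
  { star≼a = begin
      starA (suc (m + k))              ≈⟨ starA-suc (m + k) ⟩
      starA (m + k) ⊕ starA (m + k)    ≈⟨ ⊕-cong (starA-+ m k) (starA-+ m k) ⟩
      starA m ⊛ starA k ⊕ starA m ⊛ starA k
        ≈⟨ solve 2 (λ a b → a :* b :+ a :* b := b :* (a :+ a)) ≈-refl (starA m) (starA k) ⟩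
      starA k ⊛ (starA m ⊕ starA m)
        ≲⟨ ⊛-mono (star≼a B) (⊕-mono (≼-trans (star≼a A) (a≼F A)) (star≼a A)) ⟩
      b ⊛ (F ⊕ a)                      ∎
  ; star≼F = ≼-trans (starF-superadditive m k)
      (joinF-mono (star≼a A) (star≼F A) (star≼a B) (star≼F B))
  ; a≼F = begin
      b ⊛ (F ⊕ a)              ≈⟨ solve 3 (λ a F b → b :* (F :+ a) := a :* b :+ F :* b) ≈-refl a F b ⟩
      a ⊛ b ⊕ F ⊛ b            ≲⟨ ⊕-mono (⊛-mono ≼-refl (a≼F B)) ≼-refl ⟩
      a ⊛ G ⊕ F ⊛ b            ≲⟨ ⊕-increasing _ _ ⟩
      joinF a F b G            ∎
  ; a≼path = begin
      b ⊛ (F ⊕ a)              ≲⟨ ⊛-mono (a≼path B) (⊕-mono (F≼path A) (a≼path A)) ⟩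
      pathA k ⊛ (pathF m ⊕ pathA m) ≈⟨ ⊛-cong ≈-refl (≈-trans (⊕-comm (pathF m) _) (≈-sym (pathA-suc m))) ⟩
      pathA k ⊛ pathA (suc m)  ≲⟨ pathA-superadditive m k ⟩
      pathA (suc (m + k))      ∎
  ; F≼path = ≼-trans (joinF-mono (a≼path A) (F≼path A) (a≼path B) (F≼path B))
      (≼-reflexive (pathF-join m k))
  }
  where open ≼-Reasoning

-- Values at y = 1

evalY1-mono : ∀ p q → p ≤ᶜ q → evalY1 p ≤ evalY1 q
evalY1-mono [] _ _ = z≤n
evalY1-mono (a ∷ p) [] h = +-mono-≤ (h 0) (evalY1-mono p [] (λ j → h (suc j)))
evalY1-mono (a ∷ p) (b ∷ q) h = +-mono-≤ (h 0) (evalY1-mono p q (λ j → h (suc j)))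

-- Lists with equal coefficients may differ by trailing zeros, so the values are compared by two
-- inequalities.
evalY1-cong : ∀ p q → coeff p ≈ coeff q → evalY1 p ≡ evalY1 q
evalY1-cong p q h = ℕₚ.≤-antisym (evalY1-mono p q (λ j → ℕₚ.≤-reflexive (_≈_.at h j)))
  (evalY1-mono q p (λ j → ℕₚ.≤-reflexive (sym (_≈_.at h j))))

evalY1-add1 : ∀ p q → evalY1 (add1 p q) ≡ evalY1 p + evalY1 q
evalY1-add1 [] q = refl
evalY1-add1 (a ∷ p) [] = sym (ℕₚ.+-identityʳ _)
evalY1-add1 (a ∷ p) (b ∷ q) rewrite evalY1-add1 p q = lemma a b _ _
  where
  lemma : ∀ a b u v → a + b + (u + v) ≡ a + u + (b + v)
  lemma = solve-∀

-- The factor 2 avoids the exponent m - 1 of the closed form, which is negative at m = 0.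
evalY1-starPoly : ∀ m → 2 * evalY1 (starPoly m) ≡ 2 ^ m * (m + 2)
evalY1-starPoly zero = refl
evalY1-starPoly (suc m)
  rewrite evalY1-add1 (add1 (starPoly m) (0 ∷ starPoly m)) (2 ^ m ∷ [])
        | evalY1-add1 (starPoly m) (0 ∷ starPoly m) = begin
  2 * (s + s + (2 ^ m + 0))          ≡⟨ lemma₁ s (2 ^ m) ⟩
  2 * s + 2 * s + 2 * 2 ^ m          ≡⟨ cong (λ t → t + t + 2 * 2 ^ m) (evalY1-starPoly m) ⟩
  2 ^ m * (m + 2) + 2 ^ m * (m + 2) + 2 * 2 ^ m ≡⟨ lemma₂ m (2 ^ m) ⟩
  2 * 2 ^ m * (suc m + 2)            ∎
  where
  open ≡-Reasoning
  s = evalY1 (starPoly m)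
  lemma₁ : ∀ s t → 2 * (s + s + (t + 0)) ≡ 2 * s + 2 * s + 2 * t
  lemma₁ = solve-∀
  lemma₂ : ∀ m t → t * (m + 2) + t * (m + 2) + 2 * t ≡ 2 * t * (suc m + 2)
  lemma₂ = solve-∀

-- One more edge moves both Fibonacci indices by two, since at y = 1 the recurrences are a + F and
-- 2F + a.
evalY1-pathPolyA : ∀ m → evalY1 (pathPolyA m) ≡ fib (suc (2 * m))
evalY1-pathPolyF : ∀ m → evalY1 (pathPolyF m) ≡ fib (suc (suc (2 * m)))
evalY1-pathPolyA zero = refl
evalY1-pathPolyA (suc m)
  rewrite evalY1-add1 (pathPolyA m) (pathPolyF m) | evalY1-pathPolyA m | evalY1-pathPolyF m
        | ℕₚ.+-suc m (m + 0) = ℕₚ.+-comm (fib (suc (2 * m))) _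
evalY1-pathPolyF zero = refl
evalY1-pathPolyF (suc m)
  rewrite evalY1-add1 (pathPolyF m) (add1 (pathPolyA m) (0 ∷ pathPolyF m))
        | evalY1-add1 (pathPolyA m) (0 ∷ pathPolyF m) | evalY1-pathPolyA m | evalY1-pathPolyF m
        | ℕₚ.+-suc m (m + 0) = lemma (fib (suc (2 * m))) (fib (2 * m))
  where
  lemma : ∀ a b → a + b + (a + (a + b)) ≡ a + b + a + (a + b)
  lemma = solve-∀

bounded-resp : ∀ {m a F F′} → F ≈ F′ → Bounded m a F → Bounded m a F′
bounded-resp p B = record
  { star≼a = star≼a B
  ; star≼F = ≼-trans (star≼F B) (≼-reflexive p)
  ; a≼F = ≼-trans (a≼F B) (≼-reflexive p)
  ; a≼path = a≼path B
  ; F≼path = ≼-trans (≼-reflexive (≈-sym p)) (F≼path B) }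

-- Two-terminal networks

-- A two-terminal network: α and β are its contributions when it does, resp. does
-- not, connect its terminals, and γ its contribution once they are identified.
-- The law is γ = β + (y − 1) α.
record Net : Set where
  field
    α β γ : Series
    law : γ ⊕ α ≈ y ⊛ α ⊕ β
open Net

unit : Net
unit = record
  { α = 𝟙 ; β = 𝟙 ; γ = y
  ; law = solve 1 (λ y → y :+ con 1 := y :* con 1 :+ con 1) ≈-refl y }

-- the series connection of a single edge with g, when the middle vertex has to
-- be connected to a terminal
extend : Net → Net
extend g = record
  { α = α g ; β = α g ⊕ β g ; γ = y ⊛ α g ⊕ β g
  ; law = solve 3 (λ y a b → y :* a :+ b :+ a := y :* a :+ (a :+ b)) ≈-refl y (α g) (β g) }

-- If g connects the terminals, h sees them identified and contributes γ; otherwise h has to connect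
-- them itself. The law makes this α symmetric in g and h.
parallel : Net → Net → Net
parallel g h = record
  { α = α g ⊛ γ h ⊕ β g ⊛ α h
  ; β = β g ⊛ β h
  ; γ = γ g ⊛ γ h
  ; law = begin
      γ g ⊛ γ h ⊕ (α g ⊛ γ h ⊕ β g ⊛ α h)
        ≈⟨ solve 5 (λ g a b h c → g :* h :+ (a :* h :+ b :* c) := (g :+ a) :* h :+ b :* c)
             ≈-refl (γ g) (α g) (β g) (γ h) (α h) ⟩
      (γ g ⊕ α g) ⊛ γ h ⊕ β g ⊛ α h
        ≈⟨ ⊕-cong (⊛-cong (law g) ≈-refl) ≈-refl ⟩
      (y ⊛ α g ⊕ β g) ⊛ γ h ⊕ β g ⊛ α h
        ≈⟨ solve 5 (λ y a b h c → (y :* a :+ b) :* h :+ b :* c := y :* a :* h :+ b :* (h :+ c))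
             ≈-refl y (α g) (β g) (γ h) (α h) ⟩
      y ⊛ α g ⊛ γ h ⊕ β g ⊛ (γ h ⊕ α h)
        ≈⟨ ⊕-cong ≈-refl (⊛-cong ≈-refl (law h)) ⟩
      y ⊛ α g ⊛ γ h ⊕ β g ⊛ (y ⊛ α h ⊕ β h)
        ≈⟨ solve 6 (λ y a b h c d → y :* a :* h :+ b :* (y :* c :+ d)
             := y :* (a :* h :+ b :* c) :+ b :* d)
             ≈-refl y (α g) (β g) (γ h) (α h) (β h) ⟩
      y ⊛ (α g ⊛ γ h ⊕ β g ⊛ α h) ⊕ β g ⊛ β h ∎
  }
  where open ≈-Reasoning

-- A leaf carrying g is absorbed into its neighbour carrying h: the route through the leaf runs
-- parallel to h.
join : Net → Net → Net
join g h = parallel h (extend g)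

-- With β as a and α as F this is the join formula for F; the one for a is the β of `join` by
-- definition.
α-join : ∀ g h → α (join g h) ≈ joinF (β g) (α g) (β h) (α h)
α-join g h = solve 5 (λ y a b c d → c :* (y :* a :+ b) :+ d :* a
    := b :* c :+ a :* d :+ y :* a :* c)
  ≈-refl y (α g) (β g) (α h) (β h)

-- Vertex identifications as partitions

-- Written exactly as the renaming in the contraction branch of `tutteρ`, so that the two agree by
-- definition.
merge : (ℕ → ℕ) → ℕ → ℕ → ℕ → ℕ
merge ρ a b w = if ρ w ≡ᵇ ρ b then ρ a else ρ w

merge-hit : ∀ ρ a b {w} → ρ w ≡ ρ b → merge ρ a b w ≡ ρ a
merge-hit ρ a b {w} p rewrite dec-true (ρ w ≟ ρ b) p = refl

merge-miss : ∀ ρ a b {w} → ρ w ≢ ρ b → merge ρ a b w ≡ ρ w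
merge-miss ρ a b {w} p rewrite dec-false (ρ w ≟ ρ b) p = refl

merge-joins : ∀ ρ a b → merge ρ a b a ≡ merge ρ a b b
merge-joins ρ a b with ρ a ≟ ρ b
... | yes p = trans (merge-hit ρ a b p) (sym (merge-hit ρ a b refl))
... | no p = trans (merge-miss ρ a b p) (sym (merge-hit ρ a b refl))

merge-resp : ∀ ρ a b {x z} → ρ x ≡ ρ z → merge ρ a b x ≡ merge ρ a b z
merge-resp ρ a b p rewrite p = refl

-- Contractions in different orders choose different representatives, so renamings are compared by
-- their kernels. Restricting to D allows an eliminated vertex to be ignored.
Coarser : (ℕ → Set) → (ℕ → ℕ) → (ℕ → ℕ) → Set
Coarser D ρ σ = ∀ x z → D x → D z → ρ x ≡ ρ z → σ x ≡ σ z

-- The universal property of contraction: `merge ρ a b` is the finest partition above ρ that joins a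
-- and b. Independence of order and orientation follows from it.
merge-least : ∀ {D ρ σ a b} → D a → D b → Coarser D ρ σ → σ a ≡ σ b → Coarser D (merge ρ a b) σ
merge-least {D} {ρ} {σ} {a} {b} da db ρ⊑σ σab x z dx dz p with ρ x ≟ ρ b | ρ z ≟ ρ b
... | yes hx | yes hz = trans (ρ⊑σ x b dx db hx) (sym (ρ⊑σ z b dz db hz))
... | no mx | no mz = ρ⊑σ x z dx dz (trans (sym (merge-miss ρ a b mx)) (trans p (merge-miss ρ a b mz)))
... | yes hx | no mz = trans (ρ⊑σ x b dx db hx) (trans (sym σab)
  (ρ⊑σ a z da dz (trans (sym (merge-hit ρ a b hx)) (trans p (merge-miss ρ a b mz)))))
... | no mx | yes hz = trans (ρ⊑σ x a dx da (trans (sym (merge-miss ρ a b mx)) (trans p (merge-hit ρ a b hz))))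
  (trans σab (ρ⊑σ b z db dz (sym hz)))

merge-mono : ∀ {D ρ σ a b} → D a → D b → Coarser D ρ σ → Coarser D (merge ρ a b) (merge σ a b)
merge-mono {σ = σ} {a} {b} da db ρ⊑σ =
  merge-least da db (λ x z dx dz p → merge-resp σ a b (ρ⊑σ x z dx dz p)) (merge-joins σ a b)

Coarser⊤ : (ρ σ : ℕ → ℕ) → Set
Coarser⊤ = Coarser (λ _ → ⊤)

merge-least⊤ : ∀ {ρ σ a b} → Coarser⊤ ρ σ → σ a ≡ σ b → Coarser⊤ (merge ρ a b) σ
merge-least⊤ = merge-least {D = λ _ → ⊤} tt tt

merge-refines : ∀ ρ a b → Coarser⊤ ρ (merge ρ a b)
merge-refines ρ a b _ _ _ _ = merge-resp ρ a b

-- The expansion and its invariance under permutations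

Weighted : Set
Weighted = List (Edge × Net)

-- The deletion–contraction expansion of T(1,y) of a network, where the recursion
-- treats coloops like the other edges: a state in which some vertex of S is not
-- connected to n at the end contributes 0.
opaque
  Φ : ℕ → List ℕ → (ℕ → ℕ) → Weighted → Series
  Φ n S ρ [] = if does (All.all? (λ s → ρ s ≟ ρ n) S) then 𝟙 else 𝟘
  Φ n S ρ (((a , b) , g) ∷ es) =
    if ρ a ≡ᵇ ρ b then γ g ⊛ Φ n S ρ es
    else β g ⊛ Φ n S ρ es ⊕ α g ⊛ Φ n S (merge ρ a b) es

  Φ-connected : ∀ {n S ρ} → All (λ s → ρ s ≡ ρ n) S → Φ n S ρ [] ≡ 𝟙
  Φ-connected {n} {S} {ρ} p rewrite dec-true (All.all? (λ s → ρ s ≟ ρ n) S) p = refl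

  Φ-disconnected : ∀ {n S ρ} → ¬ All (λ s → ρ s ≡ ρ n) S → Φ n S ρ [] ≡ 𝟘
  Φ-disconnected {n} {S} {ρ} p rewrite dec-false (All.all? (λ s → ρ s ≟ ρ n) S) p = refl

  Φ-loop : ∀ {n S ρ a b g es} → ρ a ≡ ρ b → Φ n S ρ (((a , b) , g) ∷ es) ≡ γ g ⊛ Φ n S ρ es
  Φ-loop {ρ = ρ} {a} {b} p rewrite dec-true (ρ a ≟ ρ b) p = refl

  Φ-link : ∀ {n S ρ a b g es} → ρ a ≢ ρ b →
    Φ n S ρ (((a , b) , g) ∷ es) ≡ β g ⊛ Φ n S ρ es ⊕ α g ⊛ Φ n S (merge ρ a b) es
  Φ-link {ρ = ρ} {a} {b} p rewrite dec-false (ρ a ≟ ρ b) p = refl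

Φ-cong-[] : ∀ {n S S′ ρ σ} → (All (λ s → ρ s ≡ ρ n) S → All (λ s → σ s ≡ σ n) S′) →
  (All (λ s → σ s ≡ σ n) S′ → All (λ s → ρ s ≡ ρ n) S) → Φ n S ρ [] ≡ Φ n S′ σ []
Φ-cong-[] {n} {S} {S′} {ρ} {σ} f g with All.all? (λ s → ρ s ≟ ρ n) S
... | yes p = trans (Φ-connected p) (sym (Φ-connected (f p)))
... | no p = trans (Φ-disconnected p) (sym (Φ-disconnected (λ q → p (g q))))

-- The tails are compared at every coarser σ, because the expansion reaches them both at ρ and after
-- a contraction.
Φ-cong-∷ : ∀ {n S S′ ρ e es es′} → (∀ σ → Coarser (λ _ → ⊤) ρ σ → Φ n S σ es ≈ Φ n S′ σ es′) →
  Φ n S ρ (e ∷ es) ≈ Φ n S′ ρ (e ∷ es′)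
Φ-cong-∷ {ρ = ρ} {e = (a , b) , g} h with ρ a ≟ ρ b
... | yes p = ≈-trans (≈-reflexive (Φ-loop p)) (≈-trans (⊛-cong ≈-refl (h ρ (λ _ _ _ _ p → p)))
  (≈-reflexive (sym (Φ-loop p))))
... | no p = ≈-trans (≈-reflexive (Φ-link p))
  (≈-trans (⊕-cong (⊛-cong ≈-refl (h ρ (λ _ _ _ _ p → p)))
                   (⊛-cong ≈-refl (h (merge ρ a b) (merge-refines ρ a b))))
  (≈-reflexive (sym (Φ-link p))))

Φ-kernel : ∀ {n S ρ σ es} (D : ℕ → Set) → D n → All D S →
  All (λ e → D (proj₁ (proj₁ e)) × D (proj₂ (proj₁ e))) es →
  Coarser D ρ σ → Coarser D σ ρ → Φ n S ρ es ≈ Φ n S σ es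
Φ-kernel {n} {es = []} D dn dS [] ρ⊑σ σ⊑ρ = ≈-reflexive (Φ-cong-[]
  (λ p → All.zipWith (λ { (d , q) → ρ⊑σ _ n d dn q }) (dS , p))
  (λ p → All.zipWith (λ { (d , q) → σ⊑ρ _ n d dn q }) (dS , p)))
Φ-kernel {n} {S} {ρ} {σ} {((a , b) , g) ∷ es} D dn dS ((da , db) ∷ des) ρ⊑σ σ⊑ρ with ρ a ≟ ρ b
... | yes p = begin
  Φ n S ρ (((a , b) , g) ∷ es)   ≡⟨ Φ-loop p ⟩
  γ g ⊛ Φ n S ρ es               ≈⟨ ⊛-cong ≈-refl (Φ-kernel D dn dS des ρ⊑σ σ⊑ρ) ⟩
  γ g ⊛ Φ n S σ es               ≡⟨ Φ-loop (ρ⊑σ a b da db p) ⟨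
  Φ n S σ (((a , b) , g) ∷ es)   ∎
  where open ≈-Reasoning
... | no p = begin
  Φ n S ρ (((a , b) , g) ∷ es)
    ≡⟨ Φ-link p ⟩
  β g ⊛ Φ n S ρ es ⊕ α g ⊛ Φ n S (merge ρ a b) es
    ≈⟨ ⊕-cong (⊛-cong ≈-refl (Φ-kernel D dn dS des ρ⊑σ σ⊑ρ))
         (⊛-cong ≈-refl (Φ-kernel D dn dS des (merge-mono da db ρ⊑σ) (merge-mono da db σ⊑ρ))) ⟩
  β g ⊛ Φ n S σ es ⊕ α g ⊛ Φ n S (merge σ a b) es
    ≡⟨ Φ-link (λ q → p (σ⊑ρ a b da db q)) ⟨
  Φ n S σ (((a , b) , g) ∷ es)   ∎
  where open ≈-Reasoning

Φ-kernel⊤ : ∀ {n S ρ σ} es → Coarser⊤ ρ σ → Coarser⊤ σ ρ → Φ n S ρ es ≈ Φ n S σ es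
Φ-kernel⊤ es = Φ-kernel (λ _ → ⊤) tt (All.universal (λ _ → tt) _) (All.universal (λ _ → tt , tt) es)

merge-comm : ∀ ρ a b c d → Coarser⊤ (merge (merge ρ a b) c d) (merge (merge ρ c d) a b)
merge-comm ρ a b c d = merge-least⊤
  (merge-mono {D = λ _ → ⊤} tt tt (merge-refines ρ c d))
  (merge-resp (merge ρ c d) a b (merge-joins ρ c d))

-- If contracting ab turns cd into a loop, the two edges were parallel modulo ρ, so contracting cd
-- turns ab into a loop.
merge-exchange : ∀ ρ a b c d → ρ c ≢ ρ d → merge ρ a b c ≡ merge ρ a b d → merge ρ c d a ≡ merge ρ c d b
merge-exchange ρ a b c d c≢d p with ρ c ≟ ρ b | ρ d ≟ ρ b
... | yes hc | yes hd = contradiction (trans hc (sym hd)) c≢d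
... | no mc | no md = contradiction (trans (sym (merge-miss ρ a b mc)) (trans p (merge-miss ρ a b md))) c≢d
... | yes hc | no md = trans
  (merge-resp ρ c d (trans (sym (merge-hit ρ a b hc)) (trans p (merge-miss ρ a b md))))
  (trans (sym (merge-joins ρ c d)) (merge-resp ρ c d hc))
... | no mc | yes hd = trans
  (merge-resp ρ c d (trans (sym (merge-hit ρ a b hd)) (trans (sym p) (merge-miss ρ a b mc))))
  (trans (merge-joins ρ c d) (merge-resp ρ c d hd))

Φ-swap-loop : ∀ {n S ρ a b g c d h es} → ρ a ≡ ρ b → ρ c ≢ ρ d →
  Φ n S ρ (((a , b) , g) ∷ ((c , d) , h) ∷ es) ≈ Φ n S ρ (((c , d) , h) ∷ ((a , b) , g) ∷ es)
Φ-swap-loop {n} {S} {ρ} {a} {b} {g} {c} {d} {h} {es} p q = begin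
  Φ n S ρ (((a , b) , g) ∷ ((c , d) , h) ∷ es)
    ≡⟨ Φ-loop p ⟩
  γ g ⊛ Φ n S ρ (((c , d) , h) ∷ es)
    ≡⟨ cong (γ g ⊛_) (Φ-link q) ⟩
  γ g ⊛ (β h ⊛ Φ n S ρ es ⊕ α h ⊛ Φ n S (merge ρ c d) es)
    ≈⟨ solve 5 (λ g b a u v → g :* (b :* u :+ a :* v) := b :* (g :* u) :+ a :* (g :* v))
         ≈-refl (γ g) (β h) (α h) _ _ ⟩
  β h ⊛ (γ g ⊛ Φ n S ρ es) ⊕ α h ⊛ (γ g ⊛ Φ n S (merge ρ c d) es)
    ≡⟨ cong₂ (λ u v → β h ⊛ u ⊕ α h ⊛ v) (Φ-loop p) (Φ-loop (merge-resp ρ c d p)) ⟨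
  β h ⊛ Φ n S ρ (((a , b) , g) ∷ es) ⊕ α h ⊛ Φ n S (merge ρ c d) (((a , b) , g) ∷ es)
    ≡⟨ Φ-link q ⟨
  Φ n S ρ (((c , d) , h) ∷ ((a , b) , g) ∷ es) ∎
  where open ≈-Reasoning

Φ-swap : ∀ {n S ρ} e f es → Φ n S ρ (e ∷ f ∷ es) ≈ Φ n S ρ (f ∷ e ∷ es)
Φ-swap {n} {S} {ρ} ((a , b) , g) ((c , d) , h) es with ρ a ≟ ρ b | ρ c ≟ ρ d
... | yes p | no q = Φ-swap-loop p q
... | no p | yes q = ≈-sym (Φ-swap-loop q p)
... | yes p | yes q = begin
  Φ n S ρ (((a , b) , g) ∷ ((c , d) , h) ∷ es)
    ≡⟨ trans (Φ-loop p) (cong (γ g ⊛_) (Φ-loop q)) ⟩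
  γ g ⊛ (γ h ⊛ Φ n S ρ es)
    ≈⟨ solve 3 (λ g h u → g :* (h :* u) := h :* (g :* u)) ≈-refl (γ g) (γ h) _ ⟩
  γ h ⊛ (γ g ⊛ Φ n S ρ es)
    ≡⟨ trans (Φ-loop q) (cong (γ h ⊛_) (Φ-loop p)) ⟨
  Φ n S ρ (((c , d) , h) ∷ ((a , b) , g) ∷ es) ∎
  where open ≈-Reasoning
... | no p | no q with merge ρ a b c ≟ merge ρ a b d
...   | no r = begin
  Φ n S ρ (((a , b) , g) ∷ ((c , d) , h) ∷ es)
    ≡⟨ trans (Φ-link p) (cong₂ (λ u v → β g ⊛ u ⊕ α g ⊛ v) (Φ-link q) (Φ-link r)) ⟩
  β g ⊛ (β h ⊛ Φ n S ρ es ⊕ α h ⊛ Φ n S (merge ρ c d) es)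
    ⊕ α g ⊛ (β h ⊛ Φ n S (merge ρ a b) es ⊕ α h ⊛ Φ n S (merge (merge ρ a b) c d) es)
    ≈⟨ ⊕-cong ≈-refl (⊛-cong ≈-refl (⊕-cong ≈-refl (⊛-cong ≈-refl
         (Φ-kernel⊤ es (merge-comm ρ a b c d) (merge-comm ρ c d a b))))) ⟩
  β g ⊛ (β h ⊛ Φ n S ρ es ⊕ α h ⊛ Φ n S (merge ρ c d) es)
    ⊕ α g ⊛ (β h ⊛ Φ n S (merge ρ a b) es ⊕ α h ⊛ Φ n S (merge (merge ρ c d) a b) es)
    ≈⟨ solve 8 (λ g h g′ h′ u v w z → g :* (h :* u :+ h′ :* v) :+ g′ :* (h :* w :+ h′ :* z)
         := h :* (g :* u :+ g′ :* w) :+ h′ :* (g :* v :+ g′ :* z))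
         ≈-refl (β g) (β h) (α g) (α h) _ _ _ _ ⟩
  β h ⊛ (β g ⊛ Φ n S ρ es ⊕ α g ⊛ Φ n S (merge ρ a b) es)
    ⊕ α h ⊛ (β g ⊛ Φ n S (merge ρ c d) es ⊕ α g ⊛ Φ n S (merge (merge ρ c d) a b) es)
    ≡⟨ trans (Φ-link q) (cong₂ (λ u v → β h ⊛ u ⊕ α h ⊛ v) (Φ-link p)
         (Φ-link (λ s → r (merge-exchange ρ c d a b p s)))) ⟨
  Φ n S ρ (((c , d) , h) ∷ ((a , b) , g) ∷ es) ∎
  where open ≈-Reasoning
-- The edges are parallel: contracting either makes the other a loop and leaves the same partition,
-- whence A ≈ C. With `α g ⊛ α h ⊛ A` added, `law` replaces γ and the expression becomes symmetric
-- in g and h.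
...   | yes r = ⊕-cancelʳ (α g ⊛ α h ⊛ A) (begin
  Φ n S ρ (((a , b) , g) ∷ ((c , d) , h) ∷ es) ⊕ α g ⊛ α h ⊛ A
    ≡⟨ cong (_⊕ α g ⊛ α h ⊛ A)
         (trans (Φ-link p) (cong₂ (λ u v → β g ⊛ u ⊕ α g ⊛ v) (Φ-link q) (Φ-loop r))) ⟩
  β g ⊛ (β h ⊛ E ⊕ α h ⊛ C) ⊕ α g ⊛ (γ h ⊛ A) ⊕ α g ⊛ α h ⊛ A
    ≈⟨ ⊕-cong (⊕-cong (⊛-cong ≈-refl (⊕-cong (≈-refl {β h ⊛ E}) (⊛-cong ≈-refl (≈-sym A≈C)))) (≈-refl {α g ⊛ (γ h ⊛ A)})) (≈-refl {α g ⊛ α h ⊛ A}) ⟩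
  β g ⊛ (β h ⊛ E ⊕ α h ⊛ A) ⊕ α g ⊛ (γ h ⊛ A) ⊕ α g ⊛ α h ⊛ A
    ≈⟨ solve 7 (λ bg ag bh ah gh e a →
         bg :* (bh :* e :+ ah :* a) :+ ag :* (gh :* a) :+ ag :* ah :* a
         := bg :* (bh :* e :+ ah :* a) :+ ag :* (gh :+ ah) :* a)
         ≈-refl (β g) (α g) (β h) (α h) (γ h) E A ⟩
  β g ⊛ (β h ⊛ E ⊕ α h ⊛ A) ⊕ α g ⊛ (γ h ⊕ α h) ⊛ A
    ≈⟨ ⊕-cong ≈-refl (⊛-cong (⊛-cong ≈-refl (law h)) ≈-refl) ⟩
  β g ⊛ (β h ⊛ E ⊕ α h ⊛ A) ⊕ α g ⊛ (y ⊛ α h ⊕ β h) ⊛ A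
    ≈⟨ solve 7 (λ bg ag bh ah y e a →
         bg :* (bh :* e :+ ah :* a) :+ ag :* (y :* ah :+ bh) :* a
         := bh :* (bg :* e :+ ag :* a) :+ ah :* (y :* ag :+ bg) :* a)
         ≈-refl (β g) (α g) (β h) (α h) y E A ⟩
  β h ⊛ (β g ⊛ E ⊕ α g ⊛ A) ⊕ α h ⊛ (y ⊛ α g ⊕ β g) ⊛ A
    ≈⟨ ⊕-cong ≈-refl (⊛-cong (⊛-cong ≈-refl (law g)) ≈-refl) ⟨
  β h ⊛ (β g ⊛ E ⊕ α g ⊛ A) ⊕ α h ⊛ (γ g ⊕ α g) ⊛ A
    ≈⟨ solve 7 (λ bg ag bh ah gg e a →
         bh :* (bg :* e :+ ag :* a) :+ ah :* (gg :+ ag) :* a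
         := bh :* (bg :* e :+ ag :* a) :+ ah :* (gg :* a) :+ ag :* ah :* a)
         ≈-refl (β g) (α g) (β h) (α h) (γ g) E A ⟩
  β h ⊛ (β g ⊛ E ⊕ α g ⊛ A) ⊕ α h ⊛ (γ g ⊛ A) ⊕ α g ⊛ α h ⊛ A
    ≈⟨ ⊕-cong (⊕-cong (≈-refl {β h ⊛ (β g ⊛ E ⊕ α g ⊛ A)}) (⊛-cong ≈-refl (⊛-cong ≈-refl A≈C))) (≈-refl {α g ⊛ α h ⊛ A}) ⟩
  β h ⊛ (β g ⊛ E ⊕ α g ⊛ A) ⊕ α h ⊛ (γ g ⊛ C) ⊕ α g ⊛ α h ⊛ A
    ≡⟨ cong (_⊕ α g ⊛ α h ⊛ A)
         (trans (Φ-link q) (cong₂ (λ u v → β h ⊛ u ⊕ α h ⊛ v) (Φ-link p) (Φ-loop s))) ⟨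
  Φ n S ρ (((c , d) , h) ∷ ((a , b) , g) ∷ es) ⊕ α g ⊛ α h ⊛ A ∎)
  where
  open ≈-Reasoning
  E = Φ n S ρ es
  A = Φ n S (merge ρ a b) es
  C = Φ n S (merge ρ c d) es
  s : merge ρ c d a ≡ merge ρ c d b
  s = merge-exchange ρ a b c d q r
  A≈C : A ≈ C
  A≈C = Φ-kernel⊤ es (merge-least⊤ (merge-refines ρ c d) s)
                     (merge-least⊤ (merge-refines ρ a b) r)

Φ-↭ : ∀ {n S ρ es es′} → es ↭ es′ → Φ n S ρ es ≈ Φ n S ρ es′
Φ-↭ ↭.refl = ≈-refl
Φ-↭ (↭.prep e p) = Φ-cong-∷ {e = e} (λ _ _ → Φ-↭ p)
Φ-↭ (↭.swap e f p) = ≈-trans (Φ-swap e f _)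
  (Φ-cong-∷ {e = f} (λ _ _ → Φ-cong-∷ {e = e} (λ _ _ → Φ-↭ p)))
Φ-↭ (↭.trans p q) = ≈-trans (Φ-↭ p) (Φ-↭ q)

Φ-flip : ∀ {n S ρ} a b g es → Φ n S ρ (((a , b) , g) ∷ es) ≈ Φ n S ρ (((b , a) , g) ∷ es)
Φ-flip {n} {S} {ρ} a b g es with ρ a ≟ ρ b
... | yes p = ≈-reflexive (trans (Φ-loop p) (sym (Φ-loop (sym p))))
... | no p = begin
  Φ n S ρ (((a , b) , g) ∷ es)   ≡⟨ Φ-link p ⟩
  β g ⊛ Φ n S ρ es ⊕ α g ⊛ Φ n S (merge ρ a b) es
    ≈⟨ ⊕-cong ≈-refl (⊛-cong ≈-refl (Φ-kernel⊤ es (coarser a b) (coarser b a))) ⟩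
  β g ⊛ Φ n S ρ es ⊕ α g ⊛ Φ n S (merge ρ b a) es
                                 ≡⟨ Φ-link (p ∘ sym) ⟨
  Φ n S ρ (((b , a) , g) ∷ es)   ∎
  where
  open ≈-Reasoning
  coarser : ∀ a b → Coarser⊤ (merge ρ a b) (merge ρ b a)
  coarser a b = merge-least⊤ (merge-refines ρ b a) (sym (merge-joins ρ b a))

-- Required vertices and the absorption of a leaf

Φ-vertices : ∀ {n S S′ ρ} es → (∀ {v} → v ∈ S → v ∈ S′) → (∀ {v} → v ∈ S′ → v ∈ S) →
  Φ n S ρ es ≈ Φ n S′ ρ es
Φ-vertices [] f g = ≈-reflexive (Φ-cong-[]
  (λ p → All.tabulate (All.lookup p ∘ g)) (λ p → All.tabulate (All.lookup p ∘ f)))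
Φ-vertices (e ∷ es) f g = Φ-cong-∷ {e = e} (λ _ _ → Φ-vertices es f g)

-- No remaining edge touches the class of c, so no contraction can connect it to n. This is why
-- deleting a coloop counts as 0.
Φ-isolated : ∀ {n S ρ c es} → c ∈ S → ρ n ≢ ρ c →
  All (λ e → ρ (proj₁ (proj₁ e)) ≢ ρ c × ρ (proj₂ (proj₁ e)) ≢ ρ c) es → Φ n S ρ es ≈ 𝟘
Φ-isolated {es = []} c∈S n≢c [] = ≈-reflexive (Φ-disconnected (λ p → n≢c (sym (All.lookup p c∈S))))
Φ-isolated {n} {S} {ρ} {c} {((a , b) , g) ∷ es} c∈S n≢c ((a≢c , b≢c) ∷ h) with ρ a ≟ ρ b
... | yes p = begin
  Φ n S ρ (((a , b) , g) ∷ es)  ≡⟨ Φ-loop p ⟩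
  γ g ⊛ Φ n S ρ es              ≈⟨ ⊛-cong ≈-refl (Φ-isolated c∈S n≢c h) ⟩
  γ g ⊛ 𝟘                       ≈⟨ solve 1 (λ g → g :* con 0 := con 0) ≈-refl (γ g) ⟩
  𝟘                             ∎
  where open ≈-Reasoning
... | no p = begin
  Φ n S ρ (((a , b) , g) ∷ es)  ≡⟨ Φ-link p ⟩
  β g ⊛ Φ n S ρ es ⊕ α g ⊛ Φ n S (merge ρ a b) es
    ≈⟨ ⊕-cong (⊛-cong ≈-refl (Φ-isolated c∈S n≢c h))
         (⊛-cong ≈-refl (Φ-isolated c∈S (apart n≢c) (All.map (λ { (u , v) → apart u , apart v }) h))) ⟩
  β g ⊛ 𝟘 ⊕ α g ⊛ 𝟘
    ≈⟨ solve 2 (λ b a → b :* con 0 :+ a :* con 0 := con 0) ≈-refl (β g) (α g) ⟩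
  𝟘                             ∎
  where
  open ≈-Reasoning
  apart : ∀ {x} → ρ x ≢ ρ c → merge ρ a b x ≢ merge ρ a b c
  apart {x} x≢c q with ρ x ≟ ρ b
  ... | yes hx = a≢c (trans (sym (merge-hit ρ a b hx)) (trans q (merge-miss ρ a b (b≢c ∘ sym))))
  ... | no mx = x≢c (trans (sym (merge-miss ρ a b mx)) (trans q (merge-miss ρ a b (b≢c ∘ sym))))

-- Identified vertices stay identified, so the final test at c is implied by the one at x.
Φ-forget : ∀ {n S ρ c x} es → ρ c ≡ ρ x → x ∈ n ∷ S → Φ n (c ∷ S) ρ es ≈ Φ n S ρ es
Φ-forget {n} {S} {ρ} {c} {x} [] p x∈ = ≈-reflexive (Φ-cong-[] {S = c ∷ S} {S} {ρ} {ρ}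
  (λ { (_ ∷ q) → q }) (λ q → trans p (All.lookup {P = λ s → ρ s ≡ ρ n} (refl ∷ q) x∈) ∷ q))
Φ-forget (e ∷ es) p x∈ = Φ-cong-∷ {e = e} (λ σ ρ⊑σ → Φ-forget es (ρ⊑σ _ _ tt tt p) x∈)

Φ-parallel : ∀ {n S ρ} a b g h es →
  Φ n S ρ (((a , b) , g) ∷ ((a , b) , h) ∷ es) ≈ Φ n S ρ (((a , b) , parallel g h) ∷ es)
Φ-parallel {n} {S} {ρ} a b g h es with ρ a ≟ ρ b
... | yes p = begin
  Φ n S ρ (((a , b) , g) ∷ ((a , b) , h) ∷ es)
    ≡⟨ trans (Φ-loop p) (cong (γ g ⊛_) (Φ-loop p)) ⟩
  γ g ⊛ (γ h ⊛ Φ n S ρ es)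
    ≈⟨ solve 3 (λ g h u → g :* (h :* u) := g :* h :* u) ≈-refl (γ g) (γ h) _ ⟩
  γ g ⊛ γ h ⊛ Φ n S ρ es
    ≡⟨ Φ-loop p ⟨
  Φ n S ρ (((a , b) , parallel g h) ∷ es) ∎
  where open ≈-Reasoning
... | no p = begin
  Φ n S ρ (((a , b) , g) ∷ ((a , b) , h) ∷ es)
    ≡⟨ trans (Φ-link p) (cong₂ (λ u v → β g ⊛ u ⊕ α g ⊛ v) (Φ-link p) (Φ-loop (merge-joins ρ a b))) ⟩
  β g ⊛ (β h ⊛ E ⊕ α h ⊛ A) ⊕ α g ⊛ (γ h ⊛ A)
    ≈⟨ solve 7 (λ bg ag bh ah gh e a → bg :* (bh :* e :+ ah :* a) :+ ag :* (gh :* a)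
         := bg :* bh :* e :+ (ag :* gh :+ bg :* ah) :* a)
         ≈-refl (β g) (α g) (β h) (α h) (γ h) E A ⟩
  β g ⊛ β h ⊛ E ⊕ (α g ⊛ γ h ⊕ β g ⊛ α h) ⊛ A
    ≡⟨ Φ-link p ⟨
  Φ n S ρ (((a , b) , parallel g h) ∷ es) ∎
  where
  open ≈-Reasoning
  E = Φ n S ρ es
  A = Φ n S (merge ρ a b) es

Avoids : ℕ → Edge × Net → Set
Avoids c ((a , b) , _) = a ≢ c × b ≢ c

-- Only these two edges meet c. Deleting both isolates c and gives 0; keeping exactly one leaves the
-- same graph without c, with total weight α + β; keeping both identifies n and r, with weight α.
Φ-extend : ∀ {n S r c} g es → r ≢ c → n ≢ c → n ≢ r → r ∈ S → All (_≢ c) S → All (Avoids c) es →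
  Φ n (c ∷ S) (λ v → v) (((r , c) , unit) ∷ ((n , c) , g) ∷ es)
    ≈ Φ n S (λ v → v) (((n , r) , extend g) ∷ es)
Φ-extend {n} {S} {r} {c} g es r≢c n≢c n≢r r∈S S≢c es≢c = begin
  Φ n (c ∷ S) ι (((r , c) , unit) ∷ ((n , c) , g) ∷ es)
    ≡⟨ trans (Φ-link {ρ = ι} r≢c) (cong₂ (λ u v → 𝟙 ⊛ u ⊕ 𝟙 ⊛ v) (Φ-link {ρ = ι} n≢c)
         (Φ-link {ρ = σ} (λ p → n≢r (trans (sym σn) (trans p σc))))) ⟩
  𝟙 ⊛ (β g ⊛ Φ n (c ∷ S) ι es ⊕ α g ⊛ Φ n (c ∷ S) (merge ι n c) es)
    ⊕ 𝟙 ⊛ (β g ⊛ Φ n (c ∷ S) σ es ⊕ α g ⊛ Φ n (c ∷ S) (merge σ n c) es)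
    ≈⟨ ⊕-cong
         (⊛-cong ≈-refl (⊕-cong (⊛-cong ≈-refl (Φ-isolated {ρ = ι} (here refl) n≢c es≢c))
           (⊛-cong ≈-refl (drop (here refl) (sym (merge-joins ι n c)) λ x≢c → merge-miss ι n c x≢c))))
         (⊛-cong ≈-refl (⊕-cong
           (⊛-cong ≈-refl (drop (there r∈S) (sym (merge-joins ι r c)) λ x≢c → merge-miss ι r c x≢c))
           (⊛-cong ≈-refl (drop (here refl) (sym (merge-joins σ n c)) agree)))) ⟩
  𝟙 ⊛ (β g ⊛ 𝟘 ⊕ α g ⊛ E) ⊕ 𝟙 ⊛ (β g ⊛ E ⊕ α g ⊛ A)
    ≈⟨ solve 4 (λ b a e x → con 1 :* (b :* con 0 :+ a :* e) :+ con 1 :* (b :* e :+ a :* x)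
         := (a :+ b) :* e :+ a :* x) ≈-refl (β g) (α g) E A ⟩
  (α g ⊕ β g) ⊛ E ⊕ α g ⊛ A
    ≡⟨ Φ-link {ρ = ι} n≢r ⟨
  Φ n S ι (((n , r) , extend g) ∷ es) ∎
  where
  open ≈-Reasoning
  ι : ℕ → ℕ
  ι v = v
  σ = merge ι r c
  E = Φ n S ι es
  A = Φ n S (merge ι n r) es
  σn : σ n ≡ n
  σn = merge-miss ι r c n≢c
  σc : σ c ≡ r
  σc = merge-hit ι r c refl
  agree : ∀ {x} → x ≢ c → merge σ n c x ≡ merge ι n r x
  agree {x} x≢c rewrite σn | σc | merge-miss ι r c x≢c = refl
  -- After the test at c is dropped, only the partition away from c matters.
  drop : ∀ {ρ ρ′ x} → x ∈ n ∷ S → ρ c ≡ ρ x → (∀ {x} → x ≢ c → ρ x ≡ ρ′ x) →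
    Φ n (c ∷ S) ρ es ≈ Φ n S ρ′ es
  drop {ρ} x∈ p q = ≈-trans (Φ-forget {ρ = ρ} es p x∈) (Φ-kernel (_≢ c) n≢c S≢c es≢c
    (λ _ _ u v h → trans (sym (q u)) (trans h (q v))) (λ _ _ u v h → trans (q u) (trans h (sym (q v)))))

Φ-eliminate : ∀ {n S r c} g h es → r ≢ c → n ≢ c → n ≢ r → r ∈ S → All (_≢ c) S → All (Avoids c) es →
  Φ n (c ∷ S) (λ v → v) (((r , c) , unit) ∷ ((n , c) , g) ∷ ((n , r) , h) ∷ es)
    ≈ Φ n S (λ v → v) (((n , r) , join g h) ∷ es)
Φ-eliminate {n} {S} {r} {c} g h es r≢c n≢c n≢r r∈S S≢c es≢c = begin
  Φ n (c ∷ S) (λ v → v) (((r , c) , unit) ∷ ((n , c) , g) ∷ ((n , r) , h) ∷ es)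
    ≈⟨ Φ-extend g _ r≢c n≢c n≢r r∈S S≢c ((n≢c , r≢c) ∷ es≢c) ⟩
  Φ n S (λ v → v) (((n , r) , extend g) ∷ ((n , r) , h) ∷ es)
    ≈⟨ Φ-swap {ρ = λ v → v} _ _ es ⟩
  Φ n S (λ v → v) (((n , r) , h) ∷ ((n , r) , extend g) ∷ es)
    ≈⟨ Φ-parallel {ρ = λ v → v} n r h (extend g) es ⟩
  Φ n S (λ v → v) (((n , r) , join g h) ∷ es) ∎
  where open ≈-Reasoning

Φ-single : ∀ {n r} g → n ≢ r → Φ n (r ∷ []) (λ v → v) (((n , r) , g) ∷ []) ≈ α g
Φ-single {n} {r} g n≢r = begin
  Φ n (r ∷ []) (λ v → v) (((n , r) , g) ∷ [])
    ≡⟨ trans (Φ-link {ρ = λ v → v} n≢r) (cong₂ (λ u v → β g ⊛ u ⊕ α g ⊛ v)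
         (Φ-disconnected {ρ = λ v → v} (λ { (p ∷ _) → n≢r (sym p) }))
         (Φ-connected {ρ = merge (λ v → v) n r} (sym (merge-joins (λ v → v) n r) ∷ []))) ⟩
  β g ⊛ 𝟘 ⊕ α g ⊛ 𝟙
    ≈⟨ solve 2 (λ b a → b :* con 0 :+ a :* con 1 := a) ≈-refl (β g) (α g) ⟩
  α g ∎
  where open ≈-Reasoning

-- Comparison with the Tutte polynomial of a cone

evalX1-add2 : ∀ p q → coeff (evalX1 (add2 p q)) ≈ coeff (evalX1 p) ⊕ coeff (evalX1 q)
evalX1-add2 [] q = ≈-refl
evalX1-add2 (a ∷ p) [] = solve 1 (λ u → u := u :+ con 0) ≈-refl (coeff (evalX1 (a ∷ p)))
evalX1-add2 (a ∷ p) (b ∷ q) = begin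
  coeff (add1 (add1 a b) (evalX1 (add2 p q)))
    ≈⟨ ≈-trans (⟦add1⟧ (add1 a b) _) (⊕-cong (⟦add1⟧ a b) (evalX1-add2 p q)) ⟩
  coeff a ⊕ coeff b ⊕ (coeff (evalX1 p) ⊕ coeff (evalX1 q))
    ≈⟨ solve 4 (λ a b p q → a :+ b :+ (p :+ q) := a :+ p :+ (b :+ q)) ≈-refl
         (coeff a) (coeff b) (coeff (evalX1 p)) (coeff (evalX1 q)) ⟩
  coeff a ⊕ coeff (evalX1 p) ⊕ (coeff b ⊕ coeff (evalX1 q))
    ≈⟨ ⊕-cong (⟦add1⟧ a (evalX1 p)) (⟦add1⟧ b (evalX1 q)) ⟨
  coeff (evalX1 (a ∷ p)) ⊕ coeff (evalX1 (b ∷ q)) ∎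
  where open ≈-Reasoning

evalX1-mulY : ∀ p → coeff (evalX1 (mulY p)) ≈ y ⊛ coeff (evalX1 p)
evalX1-mulY [] = solve 1 (λ y → con 0 := y :* con 0) ≈-refl y
evalX1-mulY (a ∷ p) = begin
  coeff (add1 (0 ∷ a) (evalX1 (mulY p)))
    ≈⟨ ≈-trans (⟦add1⟧ (0 ∷ a) (evalX1 (mulY p))) (⊕-cong (⟦0∷⟧ a) (evalX1-mulY p)) ⟩
  y ⊛ coeff a ⊕ y ⊛ coeff (evalX1 p)
    ≈⟨ solve 3 (λ y a p → y :* a :+ y :* p := y :* (a :+ p)) ≈-refl y (coeff a) (coeff (evalX1 p)) ⟩
  y ⊛ (coeff a ⊕ coeff (evalX1 p))
    ≈⟨ ⊛-cong ≈-refl (⟦add1⟧ a (evalX1 p)) ⟨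
  y ⊛ coeff (evalX1 (a ∷ p)) ∎
  where open ≈-Reasoning

mem⁺ : ∀ {v S} → v ∈ S → mem v S ≡ true
mem⁺ {v} p = Equivalence.to T-≡ (any⁺ (_≡ᵇ v) (Any.map (λ { refl → ℕₚ.≡⇒≡ᵇ v v refl }) p))

mem⁻ : ∀ {v} S → mem v S ≡ true → v ∈ S
mem⁻ {v} S p = Any.map (λ {w} q → sym (ℕₚ.≡ᵇ⇒≡ w v q)) (any⁻ (_≡ᵇ v) S (Equivalence.from T-≡ p))

module _ {es : Graph} where

  step-⊇ : ∀ {v S} → v ∈ S → v ∈ step es S
  step-⊇ = ∈-++⁺ˡ

  iter-⊇ : ∀ k {v S} → v ∈ S → v ∈ iter k es S
  iter-⊇ zero p = p
  iter-⊇ (suc k) p = iter-⊇ k (step-⊇ p)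

  step-fwd : ∀ {a b S} → (a , b) ∈ es → a ∈ S → b ∈ step es S
  step-fwd {a} {b} {S} e p = ∈-++⁺ʳ S (∈-concatMap⁺ _ (lose e (∈-++⁺ˡ lemma)))
    where
    lemma : b ∈ (if mem a S then b ∷ [] else [])
    lemma rewrite mem⁺ p = here refl

  step-bwd : ∀ {a b S} → (a , b) ∈ es → b ∈ S → a ∈ step es S
  step-bwd {a} {b} {S} e p = ∈-++⁺ʳ S (∈-concatMap⁺ _ (lose e (∈-++⁺ʳ _ lemma)))
    where
    lemma : a ∈ (if mem b S then a ∷ [] else [])
    lemma rewrite mem⁺ p = here refl

  module _ (P : ℕ → Set) (fwd : ∀ {a b} → (a , b) ∈ es → P a → P b)
           (bwd : ∀ {a b} → (a , b) ∈ es → P b → P a) where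

    step-closed : ∀ {S} → (∀ {v} → v ∈ S → P v) → ∀ {v} → v ∈ step es S → P v
    step-closed {S} h {v} p with ∈-++⁻ S p
    ... | inj₁ q = h q
    ... | inj₂ q with find (∈-concatMap⁻ _ {xs = es} q)
    ... | (a , b) , e , r with ∈-++⁻ (if mem a S then b ∷ [] else []) r
    ...   | inj₁ s with mem a S in eq | s
    ...     | true | here refl = fwd e (h (mem⁻ S eq))
    step-closed {S} h {v} p | inj₂ q | (a , b) , e , r | inj₂ s with mem b S in eq | s
    ...     | true | here refl = bwd e (h (mem⁻ S eq))

    iter-closed : ∀ k {S} → (∀ {v} → v ∈ S → P v) → ∀ {v} → v ∈ iter k es S → P v
    iter-closed zero h = h
    iter-closed (suc k) h = iter-closed k (step-closed h)

    -- Soundness of the search, phrased with an edge-invariant property in place of a walk.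
    reachable-closed : ∀ {u v} → reachable es u v ≡ true → P u → P v
    reachable-closed {u} r p = iter-closed (suc (length es)) {u ∷ []} (λ { (here refl) → p })
      (mem⁻ (iter (suc (length es)) es (u ∷ [])) r)

  reachable-edge : ∀ {u v} → (u , v) ∈ es → reachable es u v ≡ true
  reachable-edge e = mem⁺ (iter-⊇ (length es) (step-fwd e (here refl)))

  -- For the apex w this shows that a tree edge of a cone is never a coloop. Two rounds of the
  -- search suffice, and a nonempty edge list provides them.
  reachable-bwd-fwd : ∀ {u v w} → (w , u) ∈ es → (w , v) ∈ es → reachable es u v ≡ true
  reachable-bwd-fwd {u} {v} {w} e f = mem⁺ (lemma (length es) (nonempty e))
    where
    nonempty : ∀ {e : Edge} {fs : Graph} → e ∈ fs → 0 < length fs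
    nonempty (here _) = s≤s z≤n
    nonempty (there _) = s≤s z≤n
    lemma : ∀ k → 0 < k → v ∈ iter k es (step es (u ∷ []))
    lemma (suc k) _ = iter-⊇ k (step-fwd f (step-bwd e (here refl)))

units : Graph → Weighted
units = map (_, unit)

spokes : ℕ → List ℕ → Graph
spokes n = map (λ i → (n , i))

-- The two expansions differ only at coloops, whose deletion contributes 0 to Φ; the
-- hypothesis says that every vertex of S is still connected to n.
tutteρ-spokes : ∀ {n S} ρ V → (∀ {v} → v ∈ V → v ∈ S) →
  (∀ {s} → s ∈ S → ρ s ≡ ρ n ⊎ ∃ λ j → j ∈ V × ρ s ≡ ρ j) →
  coeff (evalX1 (tutteρ ρ (spokes n V))) ≈ Φ n S ρ (units (spokes n V))
tutteρ-spokes {n} {S} ρ [] V⊆S inv = ≈-trans (≈-trans (⟦add1⟧ (1 ∷ []) [])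
    (solve 0 (con 1 :+ con 0 := con 1) ≈-refl))
  (≈-reflexive (sym (Φ-connected (All.tabulate (λ p → case inv p of λ { (inj₁ q) → q ; (inj₂ (_ , () , _)) })))))
tutteρ-spokes {n} {S} ρ (i ∷ V) V⊆S inv with ρ n ≟ ρ i
... | yes p rewrite dec-true (ρ n ≟ ρ i) p = begin
  coeff (evalX1 (mulY (tutteρ ρ (spokes n V))))
    ≈⟨ ≈-trans (evalX1-mulY (tutteρ ρ (spokes n V))) (⊛-cong ≈-refl (tutteρ-spokes ρ V (V⊆S ∘ there) inv′)) ⟩
  y ⊛ Φ n S ρ (units (spokes n V))
    ≡⟨ Φ-loop p ⟨
  Φ n S ρ (units (spokes n (i ∷ V))) ∎
  where
  open ≈-Reasoning
  inv′ : ∀ {s} → s ∈ S → ρ s ≡ ρ n ⊎ ∃ λ j → j ∈ V × ρ s ≡ ρ j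
  inv′ q with inv q
  ... | inj₁ r = inj₁ r
  ... | inj₂ (_ , here refl , r) = inj₁ (trans r (sym p))
  ... | inj₂ (j , there j∈ , r) = inj₂ (j , j∈ , r)
... | no p rewrite dec-false (ρ n ≟ ρ i) p
    with reachable (mapE ρ (spokes n V)) (ρ n) (ρ i) in eq
...   | true = begin
  coeff (evalX1 (add2 (tutteρ ρ (spokes n V)) (tutteρ (merge ρ n i) (spokes n V))))
    ≈⟨ evalX1-add2 (tutteρ ρ (spokes n V)) _ ⟩
  coeff (evalX1 (tutteρ ρ (spokes n V))) ⊕ coeff (evalX1 (tutteρ (merge ρ n i) (spokes n V)))
    ≈⟨ ⊕-cong (tutteρ-spokes ρ V (V⊆S ∘ there) inv′) (tutteρ-spokes (merge ρ n i) V (V⊆S ∘ there) inv″) ⟩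
  Φ n S ρ (units (spokes n V)) ⊕ Φ n S (merge ρ n i) (units (spokes n V))
    ≈⟨ solve 2 (λ u v → u :+ v := con 1 :* u :+ con 1 :* v) ≈-refl _ _ ⟩
  𝟙 ⊛ Φ n S ρ (units (spokes n V)) ⊕ 𝟙 ⊛ Φ n S (merge ρ n i) (units (spokes n V))
    ≡⟨ Φ-link p ⟨
  Φ n S ρ (units (spokes n (i ∷ V))) ∎
  where
  open ≈-Reasoning
  Hit : ℕ → Set
  Hit v = v ≡ ρ n ⊎ ∃ λ j → j ∈ V × v ≡ ρ j
  hit-edge : ∀ {a b} → (a , b) ∈ mapE ρ (spokes n V) → Hit a × Hit b
  hit-edge q with ∈-map⁻ _ q
  ... | _ , r , refl with ∈-map⁻ _ r
  ... | j , j∈ , refl = inj₁ refl , inj₂ (j , j∈ , refl)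
  -- Since the spoke to i is not a coloop, i is still attached to n after its deletion, and the
  -- invariant survives.
  hit-i : Hit (ρ i)
  hit-i = reachable-closed Hit (λ q _ → proj₂ (hit-edge q)) (λ q _ → proj₁ (hit-edge q)) eq (inj₁ refl)
  inv′ : ∀ {s} → s ∈ S → Hit (ρ s)
  inv′ q with inv q
  ... | inj₁ r = inj₁ r
  ... | inj₂ (_ , here refl , r) = subst Hit (sym r) hit-i
  ... | inj₂ (j , there j∈ , r) = inj₂ (j , j∈ , r)
  inv″ : ∀ {s} → s ∈ S → merge ρ n i s ≡ merge ρ n i n ⊎ ∃ λ j → j ∈ V × merge ρ n i s ≡ merge ρ n i j
  inv″ q with inv′ q
  ... | inj₁ r = inj₁ (merge-resp ρ n i r)
  ... | inj₂ (j , j∈ , r) = inj₂ (j , j∈ , merge-resp ρ n i r)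
...   | false = begin
  -- At x = 1 the factor x of the coloop disappears by computation; the deletion term is restored
  -- below as 0.
  coeff (evalX1 (tutteρ (merge ρ n i) (spokes n V)))
    ≈⟨ tutteρ-spokes (merge ρ n i) V (V⊆S ∘ there) inv″ ⟩
  Φ n S (merge ρ n i) (units (spokes n V))
    ≈⟨ solve 1 (λ u → u := con 1 :* con 0 :+ con 1 :* u) ≈-refl _ ⟩
  𝟙 ⊛ 𝟘 ⊕ 𝟙 ⊛ Φ n S (merge ρ n i) (units (spokes n V))
    ≈⟨ ⊕-cong (⊛-cong ≈-refl (Φ-isolated (V⊆S (here refl)) p (All.tabulate far))) ≈-refl ⟨
  𝟙 ⊛ Φ n S ρ (units (spokes n V)) ⊕ 𝟙 ⊛ Φ n S (merge ρ n i) (units (spokes n V))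
    ≡⟨ Φ-link p ⟨
  Φ n S ρ (units (spokes n (i ∷ V))) ∎
  where
  open ≈-Reasoning
  far : ∀ {e} → e ∈ units (spokes n V) → ρ (proj₁ (proj₁ e)) ≢ ρ i × ρ (proj₂ (proj₁ e)) ≢ ρ i
  far q with ∈-map⁻ _ q
  ... | e , r , refl with ∈-map⁻ _ r
  ... | j , j∈ , refl = p , λ h → case trans (sym eq) (reachable-edge
    (subst (λ v → (ρ n , v) ∈ mapE ρ (spokes n V)) h (∈-map⁺ _ r))) of λ ()
  inv″ : ∀ {s} → s ∈ S → merge ρ n i s ≡ merge ρ n i n ⊎ ∃ λ j → j ∈ V × merge ρ n i s ≡ merge ρ n i j
  inv″ q with inv q
  ... | inj₁ r = inj₁ (merge-resp ρ n i r)
  ... | inj₂ (_ , here refl , r) = inj₁ (trans (merge-resp ρ n i r) (sym (merge-joins ρ n i)))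
  ... | inj₂ (j , there j∈ , r) = inj₂ (j , j∈ , merge-resp ρ n i r)

spoke∈cone : ∀ {n v} es → v < n → (n , v) ∈ cone n es
spoke∈cone es v<n = ∈-++⁺ʳ es (∈-map⁺ _ (∈-upTo⁺ v<n))

-- Coloops can occur only among the spokes, which come last. When they are reached, every vertex
-- still has its own spoke, so the hypothesis of `tutteρ-spokes` is immediate.
tutteρ-cone : ∀ {n} ρ es → OnVertices n es →
  coeff (evalX1 (tutteρ ρ (cone n es))) ≈ Φ n (upTo n) ρ (units (cone n es))
tutteρ-cone {n} ρ [] [] = tutteρ-spokes ρ (upTo n) (λ p → p) (λ {s} p → inj₂ (s , p , refl))
tutteρ-cone {n} ρ ((a , b) ∷ es) ((a<n , b<n) ∷ es<n) with ρ a ≟ ρ b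
... | yes p rewrite dec-true (ρ a ≟ ρ b) p = begin
  coeff (evalX1 (mulY (tutteρ ρ (cone n es))))
    ≈⟨ ≈-trans (evalX1-mulY (tutteρ ρ (cone n es))) (⊛-cong ≈-refl (tutteρ-cone ρ es es<n)) ⟩
  y ⊛ Φ n (upTo n) ρ (units (cone n es))
    ≡⟨ Φ-loop p ⟨
  Φ n (upTo n) ρ (units (cone n ((a , b) ∷ es))) ∎
  where open ≈-Reasoning
... | no p rewrite dec-false (ρ a ≟ ρ b) p
                 | reachable-bwd-fwd (∈-map⁺ (λ e → ρ (proj₁ e) , ρ (proj₂ e)) (spoke∈cone es a<n))
                     (∈-map⁺ (λ e → ρ (proj₁ e) , ρ (proj₂ e)) (spoke∈cone es b<n)) = begin
  coeff (evalX1 (add2 (tutteρ ρ (cone n es)) (tutteρ (merge ρ a b) (cone n es))))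
    ≈⟨ evalX1-add2 (tutteρ ρ (cone n es)) _ ⟩
  coeff (evalX1 (tutteρ ρ (cone n es))) ⊕ coeff (evalX1 (tutteρ (merge ρ a b) (cone n es)))
    ≈⟨ ⊕-cong (tutteρ-cone ρ es es<n) (tutteρ-cone (merge ρ a b) es es<n) ⟩
  Φ n (upTo n) ρ (units (cone n es)) ⊕ Φ n (upTo n) (merge ρ a b) (units (cone n es))
    ≈⟨ solve 2 (λ u v → u :+ v := con 1 :* u :+ con 1 :* v) ≈-refl _ _ ⟩
  𝟙 ⊛ Φ n (upTo n) ρ (units (cone n es)) ⊕ 𝟙 ⊛ Φ n (upTo n) (merge ρ a b) (units (cone n es))
    ≡⟨ Φ-link p ⟨
  Φ n (upTo n) ρ (units (cone n ((a , b) ∷ es))) ∎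
  where
  open ≈-Reasoning
tutteX1-cone : ∀ n T → OnVertices n T →
  coeff (tutteX1 (cone n T)) ≈ Φ n (upTo n) (λ v → v) (units (cone n T))
tutteX1-cone n T = tutteρ-cone (λ v → v) T

-- Evaluation along an elimination order

unique-↭ : ∀ {A : Set} {xs ys : List A} → Unique xs → Unique ys →
  (∀ {x} → x ∈ xs → x ∈ ys) → (∀ {x} → x ∈ ys → x ∈ xs) → xs ↭ ys
unique-↭ u v f g = ∼bag⇒↭ (unique∧set⇒bag u v (mk⇔ f g))

-- A tree on S whose edges (parent , child) are listed so that each child is a leaf
-- of the tree formed by the later edges and itself.
data Elimination : List ℕ → Graph → Set where
  root : ∀ {r} → Elimination (r ∷ []) []
  leaf : ∀ {r c S es} → r ∈ S → c ∉ S → Elimination S es → Elimination (c ∷ S) ((r , c) ∷ es)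

elimination-within : ∀ {S es} → Elimination S es → All (λ e → proj₁ e ∈ S × proj₂ e ∈ S) es
elimination-within root = []
elimination-within (leaf r∈S _ E) =
  (there r∈S , here refl) ∷ All.map (λ { (p , q) → there p , there q }) (elimination-within E)

elimination-unique : ∀ {S es} → Elimination S es → Unique S
elimination-unique root = [] ∷ []
elimination-unique (leaf _ c∉S E) = ¬Any⇒All¬ _ c∉S ∷ elimination-unique E

-- The rooted tree absorbed so far at one vertex; `size` counts its edges.
record BoundedNet : Set where
  field
    size : ℕ
    net : Net
    bounded : Bounded size (β net) (α net)
open BoundedNet

boundedUnit : BoundedNet
boundedUnit = record { size = 0 ; net = unit ; bounded = bounded-unit }

boundedJoin : BoundedNet → BoundedNet → BoundedNet
boundedJoin g h = record
  { size = suc (size g + size h)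
  ; net = join (net g) (net h)
  ; bounded = bounded-resp (≈-sym (α-join (net g) (net h))) (bounded-join (bounded g) (bounded h)) }

BoundedNets : List ℕ → Set
BoundedNets = All (λ _ → BoundedNet)

gadgets : ∀ n {S} → BoundedNets S → Weighted
gadgets n [] = []
gadgets n (_∷_ {v} g G) = ((n , v) , net g) ∷ gadgets n G

-- Counts the original vertices, absorbed ones included; each absorption preserves it.
order : ∀ {S} → BoundedNets S → ℕ
order [] = 0
order (g ∷ G) = suc (size g) + order G

gadgets-avoid : ∀ {n c S} (G : BoundedNets S) → n ≢ c → c ∉ S → All (Avoids c) (gadgets n G)
gadgets-avoid [] n≢c c∉S = []
gadgets-avoid (g ∷ G) n≢c c∉S =
  (n≢c , λ p → c∉S (here (sym p))) ∷ gadgets-avoid G n≢c (c∉S ∘ there)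

gadgets-replace : ∀ n {r S} → r ∈ S → (G : BoundedNets S) → ∃₂ λ h rest →
  gadgets n G ↭ ((n , r) , net h) ∷ rest ×
  (∀ h′ → ∃ λ (G′ : BoundedNets S) →
    gadgets n G′ ↭ ((n , r) , net h′) ∷ rest × size h + order G′ ≡ size h′ + order G)
gadgets-replace n (here refl) (g ∷ G) = g , gadgets n G , ↭-refl , λ h′ →
  h′ ∷ G , ↭-refl , lemma (size g) (size h′) (order G)
  where
  lemma : ∀ a b c → a + (suc b + c) ≡ b + (suc a + c)
  lemma = solve-∀
gadgets-replace n {S = v ∷ _} (there r∈S) (g ∷ G) with gadgets-replace n r∈S G
... | h , rest , p , f = h , ((n , v) , net g) ∷ rest , ↭-trans (↭-prep _ p) (↭-swap _ _ ↭-refl) , λ h′ →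
  let G′ , q , eq = f h′ in
  g ∷ G′ , ↭-trans (↭-prep _ q) (↭-swap _ _ ↭-refl) ,
  trans (lemma (size h) (size g) (order G′)) (trans (cong (suc (size g) +_) eq) (sym (lemma (size h′) (size g) (order G))))
  where
  lemma : ∀ a b c → a + (suc b + c) ≡ suc b + (a + c)
  lemma = solve-∀

-- Arbitrary bounded networks on the spokes make the induction work: absorbing c leaves a smaller
-- problem of the same form, in which the spoke at r carries the joined network.
elimination-value : ∀ {n S es} → n ∉ S → Elimination S es → (G : BoundedNets S) →
  ∃ λ N → suc (size N) ≡ order G × Φ n S (λ v → v) (units es ++ gadgets n G) ≈ α (net N)
elimination-value n∉S root (g ∷ []) =
  g , sym (ℕₚ.+-identityʳ _) , Φ-single (net g) (λ p → n∉S (here p))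
elimination-value {n} {c ∷ S} {(r , c) ∷ es} n∉cS (leaf r∈S c∉S E) (g ∷ G)
  with gadgets-replace n r∈S G
... | h , rest , p , f with f (boundedJoin g h)
... | G′ , q , eq with elimination-value {n} (λ m → n∉cS (there m)) E G′
... | N , sz , val = N , trans sz (lemma₁ (size g) (size h) (order G′) (order G) eq) , (begin
  Φ n (c ∷ S) (λ v → v) (((r , c) , unit) ∷ units es ++ ((n , c) , net g) ∷ gadgets n G)
    ≈⟨ Φ-↭ (↭-prep _ (↭-trans (shift ((n , c) , net g) (units es) _)
         (↭-prep _ (↭-trans (++⁺ˡ (units es) p) (shift _ (units es) rest))))) ⟩
  Φ n (c ∷ S) (λ v → v) (((r , c) , unit) ∷ ((n , c) , net g) ∷ ((n , r) , net h) ∷ units es ++ rest)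
    ≈⟨ Φ-eliminate (net g) (net h) (units es ++ rest) (λ { refl → c∉S r∈S }) n≢c
         (λ { refl → n∉cS (there r∈S) }) r∈S
         (All.tabulate (λ { v∈S refl → c∉S v∈S }))
         (Allₚ.++⁺ (Allₚ.map⁺ (All.map (λ { (u , v) → (λ { refl → c∉S u }) , (λ { refl → c∉S v }) })
             (elimination-within E)))
           (All.tail (All-resp-↭ p (gadgets-avoid G n≢c c∉S)))) ⟩
  Φ n S (λ v → v) (((n , r) , join (net g) (net h)) ∷ units es ++ rest)
    ≈⟨ Φ-↭ (↭-trans (↭-sym (shift _ (units es) rest)) (++⁺ˡ (units es) (↭-sym q))) ⟩
  Φ n S (λ v → v) (units es ++ gadgets n G′)
    ≈⟨ val ⟩
  α (net N) ∎)
  where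
  open ≈-Reasoning
  n≢c : n ≢ c
  n≢c p = n∉cS (here p)
  lemma₁ : ∀ a b k l → b + k ≡ suc (a + b) + l → k ≡ suc a + l
  lemma₁ a b k l eq = ℕₚ.+-cancelˡ-≡ b k (suc a + l) (trans eq (lemma₂ a b l))
    where
    lemma₂ : ∀ a b l → suc (a + b) + l ≡ b + (suc a + l)
    lemma₂ = solve-∀

gadgets-unit : ∀ n S → gadgets n (All.universal (λ _ → boundedUnit) S) ≡ units (spokes n S)
gadgets-unit n [] = refl
gadgets-unit n (v ∷ S) = cong (((n , v) , unit) ∷_) (gadgets-unit n S)

order-unit : ∀ S → order (All.universal (λ _ → boundedUnit) S) ≡ length S
order-unit [] = refl
order-unit (v ∷ S) = cong suc (order-unit S)

-- An elimination order from connectedness and acyclicity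

module _ {T : Graph} where

  Traverses : Fin (length T) → ℕ → ℕ → Set
  Traverses i a b = lookup T i ≡ (a , b) ⊎ lookup T i ≡ (b , a)

  trail-cons : ∀ {i a b v is} → Traverses i a b → Trail T b v is → Trail T a v (i ∷ is)
  trail-cons {i} {v = v} {is} (inj₁ p) t = subst (λ u → Trail T u v (i ∷ is)) (cong proj₁ p)
    (fwd i (subst (λ u → Trail T u v is) (sym (cong proj₂ p)) t))
  trail-cons {i} {v = v} {is} (inj₂ p) t = subst (λ u → Trail T u v (i ∷ is)) (cong proj₂ p)
    (bwd i (subst (λ u → Trail T u v is) (sym (cong proj₁ p)) t))

  trail-snoc : ∀ {i a b u is} → Trail T u a is → Traverses i a b → Trail T u b (is ++ [ i ])
  trail-snoc nil p = trail-cons p nil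
  trail-snoc (fwd j t) p = fwd j (trail-snoc t p)
  trail-snoc (bwd j t) p = bwd j (trail-snoc t p)

  traverses-sym : ∀ {i a b} → Traverses i a b → Traverses i b a
  traverses-sym (inj₁ p) = inj₂ p
  traverses-sym (inj₂ p) = inj₁ p

  -- A subtree on the vertex set S, with edges at the positions `used` of T.
  record Subtree (S : List ℕ) : Set where
    field
      edges : Graph
      used : List (Fin (length T))
      elimination : Elimination S edges
      used-unique : Unique used
      oriented : Pointwise (λ i e → Traverses i (proj₁ e) (proj₂ e)) used edges
      trail : ∀ {a b} → a ∈ S → b ∈ S → ∃ λ is → Trail T a b is × Unique is × All (_∈ used) is
  open Subtree

  singleton : ∀ r → Subtree (r ∷ [])
  singleton r = record
    { edges = [] ; used = [] ; elimination = root ; used-unique = [] ; oriented = []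
    ; trail = λ { (here refl) (here refl) → [] , nil , [] , [] } }

  used-within : ∀ {S a b i} (s : Subtree S) → i ∈ used s → Traverses i a b → a ∈ S × b ∈ S
  used-within s = go (oriented s) (elimination-within (elimination s))
    where
    go : ∀ {S a b i is es} → Pointwise (λ i e → Traverses i (proj₁ e) (proj₂ e)) is es →
      All (λ e → proj₁ e ∈ S × proj₂ e ∈ S) es → i ∈ is → Traverses i a b → a ∈ S × b ∈ S
    go (_ ∷ ps) (_ ∷ qs) (there i∈) t = go ps qs i∈ t
    go (inj₁ p ∷ _) ((u , v) ∷ _) (here refl) (inj₁ t) with refl ← trans (sym p) t = u , v
    go (inj₁ p ∷ _) ((u , v) ∷ _) (here refl) (inj₂ t) with refl ← trans (sym p) t = v , u
    go (inj₂ p ∷ _) ((u , v) ∷ _) (here refl) (inj₁ t) with refl ← trans (sym p) t = v , u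
    go (inj₂ p ∷ _) ((u , v) ∷ _) (here refl) (inj₂ t) with refl ← trans (sym p) t = u , v

  addLeaf : ∀ {S r c i} → Subtree S → r ∈ S → c ∉ S → Traverses i r c → Subtree (c ∷ S)
  addLeaf {S} {r} {c} {i} s r∈S c∉S t = record
    { edges = (r , c) ∷ edges s
    ; used = i ∷ used s
    ; elimination = leaf r∈S c∉S (elimination s)
    ; used-unique = ¬Any⇒All¬ _ i∉ ∷ used-unique s
    ; oriented = t ∷ oriented s
    ; trail = trail′ }
    where
    i∉ : i ∉ used s
    i∉ i∈ = c∉S (proj₂ (used-within s i∈ t))
    trail′ : ∀ {a b} → a ∈ c ∷ S → b ∈ c ∷ S →
      ∃ λ is → Trail T a b is × Unique is × All (_∈ i ∷ used s) is
    trail′ (here refl) (here refl) = [] , nil , [] , []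
    trail′ (here refl) (there b∈S) with trail s r∈S b∈S
    ... | is , tr , u , w = i ∷ is , trail-cons (traverses-sym t) tr ,
      All.map (λ { j∈ refl → i∉ j∈ }) w ∷ u , here refl ∷ All.map there w
    trail′ (there a∈S) (here refl) with trail s a∈S r∈S
    ... | is , tr , u , w = is ++ [ i ] , trail-snoc tr t ,
      Uniqueₚ.++⁺ u ([] ∷ []) (λ { (j∈ , here refl) → i∉ (All.lookup w j∈) }) ,
      Allₚ.++⁺ (All.map there w) (here refl ∷ [])
    trail′ (there a∈S) (there b∈S) with trail s a∈S b∈S
    ... | is , tr , u , w = is , tr , u , All.map there w

  Spanning : ℕ → (ℕ → Set) → Set
  Spanning n P = ∃ λ S → Subtree S × All (_< n) S × (∀ {v} → P v → v ∈ S)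

  -- The subtree follows the walk: a step to a vertex outside S adds it as a leaf, a step inside S
  -- only moves the current vertex.
  extendTo : ∀ {n S u v} → OnVertices n T → Subtree S → All (_< n) S → u ∈ S → Walk T u v →
    Spanning n (λ w → w ∈ v ∷ S)
  extendStep : ∀ {n S u w v i} → OnVertices n T → Subtree S → All (_< n) S → u ∈ S →
    Traverses i u w → w < n → Walk T w v → Spanning n (λ w → w ∈ v ∷ S)

  extendTo T<n s S<n u∈S here = _ , s , S<n , λ { (here refl) → u∈S ; (there p) → p }
  extendTo T<n s S<n u∈S (fwd e walk) =
    extendStep T<n s S<n u∈S (inj₁ (sym (lookup-index e))) (proj₂ (All.lookup T<n e)) walk
  extendTo T<n s S<n u∈S (bwd e walk) =
    extendStep T<n s S<n u∈S (inj₂ (sym (lookup-index e))) (proj₁ (All.lookup T<n e)) walk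

  extendStep {S = S} {w = w} T<n s S<n u∈S t w<n walk with DecMembership._∈?_ _≟_ w S
  ... | yes w∈S = extendTo T<n s S<n w∈S walk
  ... | no w∉S with extendTo T<n (addLeaf s u∈S w∉S t) (w<n ∷ S<n) (here refl) walk
  ...   | S′ , s′ , S′<n , f = S′ , s′ , S′<n , λ { (here p) → f (here p) ; (there p) → f (there (there p)) }

  spanning : ∀ {n} → OnVertices n T → Connected n T → 0 < n → ∀ k → k ≤ n → Spanning n (_< k)
  spanning T<n conn 0<n zero _ = 0 ∷ [] , singleton 0 , 0<n ∷ [] , λ ()
  spanning T<n conn 0<n (suc k) k<n with spanning T<n conn 0<n k (ℕₚ.<⇒≤ k<n)
  ... | S , s , S<n , f with root-of (elimination s)
    where
    root-of : ∀ {S es} → Elimination S es → ∃ λ r → r ∈ S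
    root-of root = _ , here refl
    root-of (leaf _ _ _) = _ , here refl
  ... | r , r∈S with extendTo T<n s S<n r∈S (conn r k (All.lookup S<n r∈S) k<n)
  ... | S′ , s′ , S′<n , g = S′ , s′ , S′<n , λ {v} v<k → case ℕₚ.m≤n⇒m<n∨m≡n v<k of λ
    { (inj₁ (s≤s v<k)) → g (there (f v<k)) ; (inj₂ refl) → g (here refl) }

  used-all : ∀ {n S} → OnVertices n T → Acyclic T → (s : Subtree S) → (∀ {v} → v < n → v ∈ S) →
    ∀ i → i ∈ used s
  used-all T<n acyclic s f i with DecMembership._∈?_ Finₚ._≟_ i (used s)
  ... | yes i∈ = i∈
  ... | no i∉ with All.lookup T<n (∈-lookup {xs = T} i)
  ... | a<n , b<n with trail s (f b<n) (f a<n)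
  ... | is , t , u , w = ⊥-elim (acyclic (_ , i ∷ is , fwd i t ,
    All.map (λ { j∈ refl → i∉ j∈ }) w ∷ u , λ ()))

  used-↭ : ∀ {S} (s : Subtree S) → (∀ i → i ∈ used s) → T ↭ map (lookup T) (used s)
  used-↭ s f = ↭-trans
    (↭-reflexive (trans (sym (tabulate-lookup T)) (sym (map-tabulate (λ i → i) (lookup T)))))
    (↭ₚ.map⁺ (lookup T) (unique-↭ (allFin⁺ _) (used-unique s) (λ _ → f _) (λ _ → ∈-allFin _)))

  Φ-oriented : ∀ {n S ρ is es X} → Pointwise (λ i e → Traverses i (proj₁ e) (proj₂ e)) is es →
    Φ n S ρ (units (map (lookup T) is) ++ X) ≈ Φ n S ρ (units es ++ X)
  Φ-oriented [] = ≈-refl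
  Φ-oriented {X = X} (_∷_ {i} {a , b} {is} {es} t ts) = ≈-trans
    (Φ-cong-∷ {e = lookup T i , unit} {es′ = units es ++ X} (λ _ _ → Φ-oriented ts)) (orient t)
    where
    orient : ∀ {n S ρ i} → Traverses i a b → Φ n S ρ ((lookup T i , unit) ∷ units es ++ X)
      ≈ Φ n S ρ (((a , b) , unit) ∷ units es ++ X)
    orient (inj₁ p) rewrite p = ≈-refl
    orient (inj₂ p) rewrite p = Φ-flip b a unit _

tree-bounded : ∀ {n T} → IsTree (suc n) T →
  starF n ≼ coeff (tutteX1 (cone (suc n) T)) × coeff (tutteX1 (cone (suc n) T)) ≼ pathF n
tree-bounded {n} {T} (T<n , connected , acyclic)
  with spanning T<n connected (s≤s z≤n) (suc n) ≤-refl
... | S , s , S<n , f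
  with elimination-value (λ n∈S → ℕₚ.<-irrefl refl (All.lookup S<n n∈S)) (Subtree.elimination s)
         (All.universal (λ _ → boundedUnit) S)
... | N , sz , val = ≼-trans (star≼F B) (≼-reflexive (≈-sym value)) , ≼-trans (≼-reflexive value) (F≼path B)
  where
  open ≈-Reasoning
  open Bounded
  S↭ : upTo (suc n) ↭ S
  S↭ = unique-↭ (upTo⁺ (suc n)) (elimination-unique (Subtree.elimination s))
    (λ p → f (∈-upTo⁻ p)) (λ p → ∈-upTo⁺ (All.lookup S<n p))
  size≡ : size N ≡ n
  size≡ = ℕₚ.suc-injective (trans sz (trans (order-unit S)
    (trans (sym (↭-length S↭)) (length-upTo (suc n)))))
  B : Bounded n (β (net N)) (α (net N))
  B = subst (λ m → Bounded m (β (net N)) (α (net N))) size≡ (bounded N)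
  value : coeff (tutteX1 (cone (suc n) T)) ≈ α (net N)
  value = begin
    coeff (tutteX1 (cone (suc n) T))
      ≈⟨ tutteX1-cone (suc n) T T<n ⟩
    Φ (suc n) (upTo (suc n)) (λ v → v) (units (cone (suc n) T))
      ≈⟨ Φ-vertices (units (cone (suc n) T)) (↭ₚ.∈-resp-↭ S↭) (↭ₚ.∈-resp-↭ (↭-sym S↭)) ⟩
    Φ (suc n) S (λ v → v) (units (cone (suc n) T))
      ≈⟨ Φ-↭ (↭ₚ.map⁺ (λ e → e , unit) (↭ₚ.++⁺
           (used-↭ s (used-all T<n acyclic s f)) (↭ₚ.map⁺ (λ i → (suc n , i)) S↭))) ⟩
    Φ (suc n) S (λ v → v) (units (map (lookup T) (Subtree.used s) ++ spokes (suc n) S))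
      ≡⟨ cong (Φ (suc n) S (λ v → v)) (map-++ (λ e → e , unit) (map (lookup T) (Subtree.used s)) _) ⟩
    Φ (suc n) S (λ v → v) (units (map (lookup T) (Subtree.used s)) ++ units (spokes (suc n) S))
      ≈⟨ Φ-oriented {T = T} (Subtree.oriented s) ⟩
    Φ (suc n) S (λ v → v) (units (Subtree.edges s) ++ units (spokes (suc n) S))
      ≡⟨ cong (λ X → Φ (suc n) S (λ v → v) (units (Subtree.edges s) ++ X)) (gadgets-unit (suc n) S) ⟨
    Φ (suc n) S (λ v → v) (units (Subtree.edges s) ++ gadgets (suc n) (All.universal (λ _ → boundedUnit) S))
      ≈⟨ val ⟩
    α (net N) ∎

spokes-avoid : ∀ {n c V} → n ≢ c → All (_≢ c) V → All (Avoids c) (units (spokes n V))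
spokes-avoid n≢c V≢c = Allₚ.map⁺ (Allₚ.map⁺ (All.map (n≢c ,_) V≢c))

-- The network h on the spoke to the centre already contains m absorbed leaves.
star-value : ∀ {n r m h} cs → Unique (r ∷ cs) → All (n ≢_) (r ∷ cs) → α h ≈ starF m → β h ≈ starA m →
  Φ n (r ∷ cs) (λ v → v) (((n , r) , h) ∷ units (map (r ,_) cs) ++ units (spokes n cs)) ≈ starF (length cs + m)
star-value {h = h} [] _ (n≢r ∷ []) p q = ≈-trans (Φ-single h n≢r) p
star-value {n} {r} {m} {h} (c ∷ cs) ((r≢c ∷ r≢cs) ∷ c≢cs ∷ u) (n≢r ∷ n≢c ∷ n≢cs) p q = begin
  Φ n (r ∷ c ∷ cs) (λ v → v) (((n , r) , h) ∷ ((r , c) , unit) ∷ rim ++ ((n , c) , unit) ∷ units (spokes n cs))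
    ≈⟨ Φ-vertices (((n , r) , h) ∷ ((r , c) , unit) ∷ rim ++ ((n , c) , unit) ∷ units (spokes n cs))
         (↭ₚ.∈-resp-↭ (↭-swap r c ↭-refl)) (↭ₚ.∈-resp-↭ (↭-swap c r ↭-refl)) ⟩
  Φ n (c ∷ r ∷ cs) (λ v → v) (((n , r) , h) ∷ ((r , c) , unit) ∷ rim ++ ((n , c) , unit) ∷ units (spokes n cs))
    ≈⟨ Φ-↭ (↭-trans (↭-swap _ _ (shift _ rim _)) (↭-prep _ (↭-swap _ _ ↭-refl))) ⟩
  Φ n (c ∷ r ∷ cs) (λ v → v) (((r , c) , unit) ∷ ((n , c) , unit) ∷ ((n , r) , h) ∷ rim ++ units (spokes n cs))
    ≈⟨ Φ-eliminate unit h _ r≢c n≢c n≢r (here refl) (r≢c ∷ All.map ≢-sym c≢cs)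
         (Allₚ.++⁺ (Allₚ.map⁺ (Allₚ.map⁺ (All.map (λ c≢ → r≢c , ≢-sym c≢) c≢cs)))
           (spokes-avoid n≢c (All.map ≢-sym c≢cs))) ⟩
  Φ n (r ∷ cs) (λ v → v) (((n , r) , join unit h) ∷ rim ++ units (spokes n cs))
    ≈⟨ star-value cs (r≢cs ∷ u) (n≢r ∷ n≢cs) value weight ⟩
  starF (length cs + suc m)
    ≡⟨ cong starF (ℕₚ.+-suc (length cs) m) ⟩
  starF (suc (length cs + m)) ∎
  where
  open ≈-Reasoning
  rim = units (map (r ,_) cs)
  value : α (join unit h) ≈ starF (suc m)
  value = begin
    α (join unit h)            ≈⟨ ≈-trans (α-join unit h) (joinF-cong ≈-refl ≈-refl q p) ⟩
    joinF 𝟙 𝟙 (starA m) (starF m)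
      ≈⟨ solve 3 (λ y a F → con 1 :* F :+ con 1 :* a :+ y :* con 1 :* F := F :+ y :* F :+ a)
           ≈-refl y (starA m) (starF m) ⟩
    starF m ⊕ y ⊛ starF m ⊕ starA m ≈⟨ starF-suc m ⟨
    starF (suc m)              ∎
  weight : β (join unit h) ≈ starA (suc m)
  weight = begin
    β h ⊛ (𝟙 ⊕ 𝟙)              ≈⟨ ⊛-cong q ≈-refl ⟩
    starA m ⊛ (𝟙 ⊕ 𝟙)
      ≈⟨ solve 1 (λ a → a :* (con 1 :+ con 1) := a :+ a) ≈-refl (starA m) ⟩
    starA m ⊕ starA m          ≈⟨ starA-suc m ⟨
    starA (suc m)              ∎

chain : ℕ → List ℕ → Graph
chain x [] = []
chain x (w ∷ xs) = (x , w) ∷ chain w xs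

chain-avoids : ∀ {c} x xs → All (_≢ c) (x ∷ xs) → All (Avoids c) (units (chain x xs))
chain-avoids x [] _ = []
chain-avoids x (w ∷ xs) (x≢c ∷ w≢c ∷ xs≢c) = (x≢c , w≢c) ∷ chain-avoids w xs (w≢c ∷ xs≢c)

-- Unlike for the star, the accumulated network travels: the end x, holding m absorbed edges, is
-- absorbed into its successor w.
path-value : ∀ {n x m h} xs → Unique (x ∷ xs) → All (n ≢_) (x ∷ xs) → α h ≈ pathF m → β h ≈ pathA m →
  Φ n (x ∷ xs) (λ v → v) (((n , x) , h) ∷ units (chain x xs) ++ units (spokes n xs)) ≈ pathF (length xs + m)
path-value {h = h} [] _ (n≢x ∷ []) p q = ≈-trans (Φ-single h n≢x) p
path-value {n} {x} {m} {h} (w ∷ xs) ((x≢w ∷ x≢xs) ∷ u) (n≢x ∷ n≢w ∷ n≢xs) p q = begin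
  Φ n (x ∷ w ∷ xs) (λ v → v) (((n , x) , h) ∷ ((x , w) , unit) ∷ rest ++ ((n , w) , unit) ∷ units (spokes n xs))
    ≈⟨ Φ-↭ (↭-swap _ _ (shift _ rest _)) ⟩
  Φ n (x ∷ w ∷ xs) (λ v → v) (((x , w) , unit) ∷ ((n , x) , h) ∷ ((n , w) , unit) ∷ rest ++ units (spokes n xs))
    ≈⟨ Φ-flip x w unit _ ⟩
  Φ n (x ∷ w ∷ xs) (λ v → v) (((w , x) , unit) ∷ ((n , x) , h) ∷ ((n , w) , unit) ∷ rest ++ units (spokes n xs))
    ≈⟨ Φ-eliminate h unit _ (≢-sym x≢w) n≢x n≢w (here refl) (≢-sym x≢w ∷ xs≢x)
         (Allₚ.++⁺ (chain-avoids w xs (≢-sym x≢w ∷ xs≢x)) (spokes-avoid n≢x xs≢x)) ⟩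
  Φ n (w ∷ xs) (λ v → v) (((n , w) , join h unit) ∷ rest ++ units (spokes n xs))
    ≈⟨ path-value xs u (n≢w ∷ n≢xs) value weight ⟩
  pathF (length xs + suc m)
    ≡⟨ cong pathF (ℕₚ.+-suc (length xs) m) ⟩
  pathF (suc (length xs + m)) ∎
  where
  open ≈-Reasoning
  rest = units (chain w xs)
  xs≢x = All.map ≢-sym x≢xs
  value : α (join h unit) ≈ pathF (suc m)
  value = begin
    α (join h unit)                ≈⟨ ≈-trans (α-join h unit) (joinF-cong q p ≈-refl ≈-refl) ⟩
    joinF (pathA m) (pathF m) 𝟙 𝟙  ≈⟨ pathF-join m 0 ⟩
    pathF (suc (m + 0))            ≡⟨ cong (λ i → pathF (suc i)) (ℕₚ.+-identityʳ m) ⟩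
    pathF (suc m)                  ∎
  weight : β (join h unit) ≈ pathA (suc m)
  weight = begin
    𝟙 ⊛ (α h ⊕ β h)                ≈⟨ ⊛-cong (≈-refl {𝟙}) (⊕-cong p q) ⟩
    𝟙 ⊛ (pathF m ⊕ pathA m)
      ≈⟨ solve 2 (λ F a → con 1 :* (F :+ a) := a :+ F) ≈-refl (pathF m) (pathA m) ⟩
    pathA m ⊕ pathF m              ≈⟨ pathA-suc m ⟨
    pathA (suc m)                  ∎

tutteX1-cone-rooted : ∀ k es → OnVertices (suc k) es →
  coeff (tutteX1 (cone (suc k) es)) ≈ Φ (suc k) (upTo (suc k)) (λ v → v)
    (((suc k , 0) , unit) ∷ units es ++ units (spokes (suc k) (applyUpTo suc k)))
tutteX1-cone-rooted k es es<n = begin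
  coeff (tutteX1 (cone (suc k) es))
    ≈⟨ tutteX1-cone (suc k) es es<n ⟩
  Φ (suc k) (upTo (suc k)) (λ v → v) (units (cone (suc k) es))
    ≡⟨ cong (Φ (suc k) (upTo (suc k)) (λ v → v)) (map-++ (_, unit) es _) ⟩
  Φ (suc k) (upTo (suc k)) (λ v → v) (units es ++ units (spokes (suc k) (upTo (suc k))))
    ≈⟨ Φ-↭ (shift _ (units es) _) ⟩
  Φ (suc k) (upTo (suc k)) (λ v → v)
    (((suc k , 0) , unit) ∷ units es ++ units (spokes (suc k) (applyUpTo suc k))) ∎
  where open ≈-Reasoning

upTo-≢ : ∀ n → All (n ≢_) (upTo n)
upTo-≢ n = All.tabulate (λ p → ≢-sym (ℕₚ.<⇒≢ (∈-upTo⁻ p)))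

starG-onVertices : ∀ k → OnVertices (suc k) (starG (suc k))
starG-onVertices k = Allₚ.map⁺ (All.tabulate (λ p → s≤s z≤n , s≤s (∈-upTo⁻ p)))

pathG-onVertices : ∀ k → OnVertices (suc k) (pathG (suc k))
pathG-onVertices k = Allₚ.map⁺ (All.tabulate (λ p → ℕₚ.m<n⇒m<1+n (∈-upTo⁻ p) , s≤s (∈-upTo⁻ p)))

starG-map : ∀ k → starG (suc k) ≡ map (0 ,_) (applyUpTo suc k)
starG-map k = trans (map-upTo _ k) (sym (map-applyUpTo suc (0 ,_) k))

pathG-chain : ∀ k → pathG (suc k) ≡ chain 0 (applyUpTo suc k)
pathG-chain k = trans (map-upTo _ k) (go (λ i → i) k)
  where
  go : ∀ (f : ℕ → ℕ) k → applyUpTo (λ i → f i , f (suc i)) k ≡ chain (f 0) (applyUpTo (f ∘ suc) k)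
  go f zero = refl
  go f (suc k) = cong ((f 0 , f 1) ∷_) (go (f ∘ suc) k)

tutteX1-star : ∀ k → coeff (tutteX1 (cone (suc k) (starG (suc k)))) ≈ starF k
tutteX1-star k = begin
  coeff (tutteX1 (cone (suc k) (starG (suc k))))
    ≈⟨ tutteX1-cone-rooted k _ (starG-onVertices k) ⟩
  Φ (suc k) (upTo (suc k)) (λ v → v)
    (((suc k , 0) , unit) ∷ units (starG (suc k)) ++ units (spokes (suc k) cs))
    ≡⟨ cong (λ G → Φ (suc k) (upTo (suc k)) (λ v → v)
         (((suc k , 0) , unit) ∷ units G ++ units (spokes (suc k) cs))) (starG-map k) ⟩
  Φ (suc k) (upTo (suc k)) (λ v → v)
    (((suc k , 0) , unit) ∷ units (map (0 ,_) cs) ++ units (spokes (suc k) cs))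
    ≈⟨ star-value cs (upTo⁺ (suc k)) (upTo-≢ (suc k)) ≈-refl ≈-refl ⟩
  starF (length cs + 0)
    ≡⟨ cong starF (trans (ℕₚ.+-identityʳ _) (length-applyUpTo suc k)) ⟩
  starF k ∎
  where
  open ≈-Reasoning
  cs = applyUpTo suc k

tutteX1-path : ∀ k → coeff (tutteX1 (cone (suc k) (pathG (suc k)))) ≈ pathF k
tutteX1-path k = begin
  coeff (tutteX1 (cone (suc k) (pathG (suc k))))
    ≈⟨ tutteX1-cone-rooted k _ (pathG-onVertices k) ⟩
  Φ (suc k) (upTo (suc k)) (λ v → v)
    (((suc k , 0) , unit) ∷ units (pathG (suc k)) ++ units (spokes (suc k) xs))
    ≡⟨ cong (λ G → Φ (suc k) (upTo (suc k)) (λ v → v)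
         (((suc k , 0) , unit) ∷ units G ++ units (spokes (suc k) xs))) (pathG-chain k) ⟩
  Φ (suc k) (upTo (suc k)) (λ v → v)
    (((suc k , 0) , unit) ∷ units (chain 0 xs) ++ units (spokes (suc k) xs))
    ≈⟨ path-value xs (upTo⁺ (suc k)) (upTo-≢ (suc k)) ≈-refl ≈-refl ⟩
  pathF (length xs + 0)
    ≡⟨ cong pathF (trans (ℕₚ.+-identityʳ _) (length-applyUpTo suc k)) ⟩
  pathF k ∎
  where
  open ≈-Reasoning
  xs = applyUpTo suc k

-- Spanning tree counts and the conclusion

τ-star : ∀ k → 2 ^ k * (suc (suc k) + 1) ≡ τ (cone (suc (suc k)) (starG (suc (suc k))))
τ-star k = trans (ℕₚ.*-cancelˡ-≡ _ _ 2 (begin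
  2 * (2 ^ k * (suc (suc k) + 1))    ≡⟨ lemma k (2 ^ k) ⟩
  2 * 2 ^ k * (suc k + 2)            ≡⟨ evalY1-starPoly (suc k) ⟨
  2 * evalY1 (starPoly (suc k))      ∎))
  (sym (evalY1-cong (tutteX1 (cone (suc (suc k)) (starG (suc (suc k))))) (starPoly (suc k)) (tutteX1-star (suc k))))
  where
  open ≡-Reasoning
  lemma : ∀ k t → 2 * (t * (suc (suc k) + 1)) ≡ 2 * t * (suc k + 2)
  lemma = solve-∀

τ-path : ∀ k → τ (cone (suc k) (pathG (suc k))) ≡ fib (2 * suc k)
τ-path k = begin
  τ (cone (suc k) (pathG (suc k)))
    ≡⟨ evalY1-cong (tutteX1 (cone (suc k) (pathG (suc k)))) (pathPolyF k) (tutteX1-path k) ⟩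
  evalY1 (pathPolyF k)               ≡⟨ evalY1-pathPolyF k ⟩
  fib (2 + 2 * k)                    ≡⟨ cong fib (ℕₚ.*-suc 2 k) ⟨
  fib (2 * suc k)                    ∎
  where open ≡-Reasoning

theorem1p4 : (n : ℕ) → 2 ≤ n → (T : Graph) → IsTree n T →
    (tutteX1 (cone n (starG n)) ≤ᶜ tutteX1 (cone n T))
    × (tutteX1 (cone n T) ≤ᶜ tutteX1 (cone n (pathG n)))
    × (2 ^ (n ∸ 2) * (n + 1) ≡ τ (cone n (starG n)))
    × (τ (cone n (starG n)) ≤ τ (cone n T))
    × (τ (cone n T) ≤ τ (cone n (pathG n)))
    × (τ (cone n (pathG n)) ≡ fib (2 * n))
theorem1p4 (suc (suc k)) (s≤s (s≤s _)) T tree =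
  star≤T , T≤path , τ-star k ,
  evalY1-mono (tutteX1 (cone n (starG n))) (tutteX1 (cone n T)) star≤T ,
  evalY1-mono (tutteX1 (cone n T)) (tutteX1 (cone n (pathG n))) T≤path , τ-path (suc k)
  where
  n = suc (suc k)
  star≤T : tutteX1 (cone n (starG n)) ≤ᶜ tutteX1 (cone n T)
  star≤T = _≼_.at≼ (≼-trans (≼-reflexive (tutteX1-star (suc k))) (proj₁ (tree-bounded tree)))
  T≤path : tutteX1 (cone n T) ≤ᶜ tutteX1 (cone n (pathG n))
  T≤path = _≼_.at≼ (≼-trans (proj₂ (tree-bounded tree)) (≼-reflexive (≈-sym (tutteX1-path (suc k)))))
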